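{- The generating function $G_5(x)=\sum_{n\ge0}g_{5,n}x^n$ for Greek key tours on height $5$ grid graphs is $G_5(x)=P(x)/Q(x)$, where $$P(x)=1-3x-13x^2+58x^3+25x^4-162x^5+63x^6+113x^7-61x^8+12x^9-11x^{10}+25x^{11}-17x^{12}+5x^{13}-3x^{14},$$ $$Q(x)=(1+x)(1-11x^2-2x^6)(1-5x+2x^2+8x^3-8x^4+x^5-x^6).$$
   Context: A Greek key tour on the $k\times n$ grid graph ($k$ rows, $n$ columns; vertices are integer points, edges join points at distance $1$) is a directed self-avoiding walk that starts at the upper-left corner vertex and visits every vertex of the grid exactly once. $g_{k,n}$ denotes the number of Greek key tours on the $k\times n$ grid graph, with the convention $g_{k,0}=1$. -}

module Defs where

open import Data.Fin.Base using (Fin; toℕ)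
import Data.Fin.Properties as Fin
open import Data.Integer.Base as ℤ using (ℤ; +_; -_; 0ℤ)
open import Data.List.Base
  using (List; []; _∷_; head; length; map; filter; foldr; applyUpTo; allFin; cartesianProduct; cartesianProductWith)
import Data.List.Properties as List
open import Data.List.Membership.Propositional using (_∈_)
open import Data.List.Membership.Propositional.Properties
  using (∈-allFin; ∈-cartesianProduct⁺; ∈-cartesianProductWith⁺; ∈-filter⁺; ∈-filter⁻)
open import Data.List.Relation.Binary.Permutation.Propositional.Properties using (↭-length)
open import Data.List.Membership.Propositional.Properties.WithK using (unique∧set⇒bag)
open import Data.List.Relation.Binary.BagAndSetEquality using (∼bag⇒↭)
open import Data.List.Relation.Unary.All using ([])
open import Data.List.Relation.Unary.AllPairs using ([]; _∷_)
open import Data.List.Relation.Unary.Any using (here)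
open import Data.List.Relation.Unary.Linked as Linked using (Linked)
open import Data.List.Relation.Unary.Unique.Propositional using (Unique)
import Data.List.Relation.Unary.Unique.Propositional.Properties as Unique
import Data.List.Membership.DecPropositional as DecMembership
import Data.List.Relation.Unary.Unique.DecPropositional as DecUnique
import Data.Maybe.Relation.Unary.Any as Maybe
open import Data.Nat.Base using (ℕ; zero; suc; _+_; _*_; _∸_; _^_; ∣_-_∣)
open import Data.Nat.Properties using (_≟_)
open import Data.Product.Base using (_×_; _,_; proj₂)
open import Data.Product.Properties using (≡-dec)
open import Function.Base using (const)
open import Function.Bundles using (_⇔_; mk⇔)
open import Relation.Binary.Definitions using (Decidable; DecidableEquality)
open import Relation.Binary.PropositionalEquality using (_≡_; refl; trans; cong₂; subst)
open import Relation.Nullary.Decidable using (_×-dec_; map′)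
import Relation.Unary as Unary

-- A vertex is (row , column); row 0 is the top row and column 0 the leftmost.
Vertex : ℕ → ℕ → Set
Vertex k n = Fin k × Fin n

UpperLeft : ∀ {k n} → Vertex k n → Set
UpperLeft (i , j) = toℕ i ≡ 0 × toℕ j ≡ 0

-- Euclidean distance 1, written with the squared distance to stay in ℕ.
Adjacent : ∀ {k n} → Vertex k n → Vertex k n → Set
Adjacent (i , j) (i′ , j′) = ∣ toℕ i - toℕ i′ ∣ ^ 2 + ∣ toℕ j - toℕ j′ ∣ ^ 2 ≡ 1

-- Together, Unique and ∀ v → v ∈ w say that every vertex is visited exactly once.
IsGreekKeyTour : ∀ k n → List (Vertex k n) → Set
IsGreekKeyTour k n w =
    Maybe.Any UpperLeft (head w)
  × Linked Adjacent w
  × Unique w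
  × (∀ v → v ∈ w)

module _ {k n : ℕ} where

  upperLeft? : Unary.Decidable (UpperLeft {k} {n})
  upperLeft? (i , j) = (toℕ i ≟ 0) ×-dec (toℕ j ≟ 0)

  adjacent? : Decidable (Adjacent {k} {n})
  adjacent? (i , j) (i′ , j′) = _ ≟ 1

  _≟ᵛ_ : DecidableEquality (Vertex k n)
  _≟ᵛ_ = ≡-dec Fin._≟_ Fin._≟_

  open DecMembership _≟ᵛ_ using (_∈?_)
  open DecUnique _≟ᵛ_ using (unique?)

  isGreekKeyTour? : Unary.Decidable (IsGreekKeyTour k n)
  isGreekKeyTour? w =
          Maybe.dec upperLeft? (head w)
    ×-dec Linked.linked? adjacent? w
    ×-dec unique? w
    ×-dec map′ (λ f (i , j) → f i j) (λ f i j → f (i , j))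
               (Fin.all? λ i → Fin.all? λ j → (i , j) ∈? w)

vertices : ∀ k n → List (Vertex k n)
vertices k n = cartesianProduct (allFin k) (allFin n)

listsOfLength : ∀ {A : Set} → ℕ → List A → List (List A)
listsOfLength zero    xs = [] ∷ []
listsOfLength (suc m) xs = cartesianProductWith _∷_ xs (listsOfLength m xs)

-- A tour of the k × n grid has exactly k * n entries, so this list contains
-- every tour once; see ∈-greekKeyTours and greekKeyTours-unique.
greekKeyTours : ∀ k n → List (List (Vertex k n))
greekKeyTours k n = filter isGreekKeyTour? (listsOfLength (k * n) (vertices k n))

-- The value at n = 0 is a convention.
g : ℕ → ℕ → ℕ
g k zero    = 1
g k (suc n) = length (greekKeyTours k (suc n))

length-cartesianProduct : ∀ {A B : Set} (xs : List A) (ys : List B) →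
                          length (cartesianProduct xs ys) ≡ length xs * length ys
length-cartesianProduct []       ys = refl
length-cartesianProduct (x ∷ xs) ys =
  trans (List.length-++ (map (x ,_) ys))
        (cong₂ _+_ (List.length-map (x ,_) ys) (length-cartesianProduct xs ys))

module _ {k n : ℕ} where

  ∈-vertices : ∀ v → v ∈ vertices k n
  ∈-vertices (i , j) = ∈-cartesianProduct⁺ (∈-allFin i) (∈-allFin j)

  vertices-unique : Unique (vertices k n)
  vertices-unique = Unique.cartesianProduct⁺ (Unique.allFin⁺ k) (Unique.allFin⁺ n)

  length-vertices : length (vertices k n) ≡ k * n
  length-vertices = trans (length-cartesianProduct (allFin k) (allFin n))
    (cong₂ _*_ (List.length-tabulate {n = k} _) (List.length-tabulate {n = n} _))

∈-listsOfLength : ∀ {A : Set} {xs : List A} → (∀ x → x ∈ xs) →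
                  ∀ w → w ∈ listsOfLength (length w) xs
∈-listsOfLength all []      = here refl
∈-listsOfLength all (x ∷ w) = ∈-cartesianProductWith⁺ _∷_ (all x) (∈-listsOfLength all w)

listsOfLength-unique : ∀ {A : Set} {xs : List A} → Unique xs → ∀ m → Unique (listsOfLength m xs)
listsOfLength-unique xs! zero    = [] ∷ []
listsOfLength-unique xs! (suc m) =
  Unique.cartesianProductWith⁺ _∷_ List.∷-injective xs! (listsOfLength-unique xs! m)

length-tour : ∀ {k n w} → IsGreekKeyTour k n w → length w ≡ k * n
length-tour {k} {n} (_ , _ , w! , all) = trans
  (↭-length (∼bag⇒↭ (unique∧set⇒bag w! (vertices-unique {k} {n})
    (λ {v} → mk⇔ (const (∈-vertices v)) (const (all v))))))
  (length-vertices {k} {n})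

∈-greekKeyTours : ∀ {k n w} → w ∈ greekKeyTours k n ⇔ IsGreekKeyTour k n w
∈-greekKeyTours {k} {n} {w} = mk⇔
  (λ w∈ → proj₂ (∈-filter⁻ isGreekKeyTour? {xs = listsOfLength (k * n) (vertices k n)} w∈))
  (λ t → ∈-filter⁺ isGreekKeyTour?
    (subst (λ m → w ∈ listsOfLength m (vertices k n)) (length-tour t) (∈-listsOfLength ∈-vertices w)) t)

greekKeyTours-unique : ∀ k n → Unique (greekKeyTours k n)
greekKeyTours-unique k n =
  Unique.filter⁺ isGreekKeyTour? (listsOfLength-unique (vertices-unique {k} {n}) (k * n))

-- Formal power series over ℤ, as coefficient sequences.
Series : Set
Series = ℕ → ℤ

infix  4 _≈_ _≈_÷_
infixl 7 _⊛_

_≈_ : Series → Series → Set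
a ≈ b = ∀ n → a n ≡ b n

-- Cauchy product: (a ⊛ b) n = Σ_{i = 0}^{n} a i * b (n - i).
_⊛_ : Series → Series → Series
(a ⊛ b) n = foldr ℤ._+_ 0ℤ (applyUpTo (λ i → a i ℤ.* b (n ∸ i)) (suc n))

-- Coefficients in order of increasing degree.
poly : List ℤ → Series
poly []       _       = 0ℤ
poly (c ∷ cs) zero    = c
poly (c ∷ cs) (suc n) = poly cs n

-- a = p / q in ℤ[[x]].  The constant term 1 makes q a unit, so the quotient
-- exists and is the only series a with a q = p.
_≈_÷_ : Series → Series → Series → Set
a ≈ p ÷ q = q 0 ≡ + 1 × a ⊛ q ≈ p

G : ℕ → Series
G k n = + g k n

P : Series
P = poly (+ 1 ∷ - + 3 ∷ - + 13 ∷ + 58 ∷ + 25 ∷ - + 162 ∷ + 63 ∷ + 113 ∷ - + 61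
          ∷ + 12 ∷ - + 11 ∷ + 25 ∷ - + 17 ∷ + 5 ∷ - + 3 ∷ [])

Q : Series
Q = poly (+ 1 ∷ + 1 ∷ [])
  ⊛ poly (+ 1 ∷ + 0 ∷ - + 11 ∷ + 0 ∷ + 0 ∷ + 0 ∷ - + 2 ∷ [])
  ⊛ poly (+ 1 ∷ - + 5 ∷ + 2 ∷ + 8 ∷ - + 8 ∷ + 1 ∷ - + 1 ∷ [])

{-# OPTIONS --safe #-}

-- A tour is a Hamiltonian path to an extra sink in a digraph.  Such paths are counted by
-- eliminating one vertex v at a time: a path passes a → v → b for exactly one pair (a , b),
-- and shortcutting it is a bijection with the Hamiltonian paths through the remaining
-- vertices in which the arc a → b is forced.  Eliminating the grid from its last column
-- backwards, the forced arcs stay within a window of five vertices and the sink, so finitely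
-- many states occur, and eliminating a column acts linearly on their formal combinations.
-- A computation with such combinations then certifies a linear recurrence for the tours.
module Submission where

open import Defs

open import Data.Bool.Base using (Bool; true; false; if_then_else_; _∧_)
open import Data.Empty using (⊥)
open import Data.Fin.Base using (toℕ; fromℕ<)
open import Data.Fin.Properties using (toℕ-injective; toℕ<n; toℕ-fromℕ<)
open import Data.Integer.Base as ℤ using (ℤ; +_; -_; 0ℤ; 1ℤ)
import Data.Integer.Properties as ℤ
open import Data.Integer.Tactic.RingSolver using (solve-∀)
open import Data.List.Base
  using (List; []; _∷_; _∷ʳ_; _++_; map; filter; foldr; head; last; length; cartesianProduct; upTo; applyUpTo;
         replicate; initLast; _∷ʳ′_)
open import Data.List.Membership.Propositional using (_∈_; _∉_)
import Data.List.Membership.DecPropositional as DecMembership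
open import Data.List.Membership.Propositional.Properties
  using (∈-map⁺; ∈-map⁻; ∈-++⁺ˡ; ∈-++⁺ʳ; ∈-++⁻; ∈-filter⁺; ∈-filter⁻; ∈-upTo⁺; ∈-upTo⁻;
         ∈-cartesianProduct⁺; ∈-cartesianProduct⁻)
open import Data.List.Membership.Propositional.Properties.WithK using (unique∧set⇒bag)
import Data.List.Properties as List
open import Data.List.Relation.Binary.BagAndSetEquality using (∼bag⇒↭)
open import Data.List.Relation.Binary.Permutation.Propositional
  using (_↭_; ↭-refl; ↭-trans; ↭-sym; prep; swap; ↭⇒↭ₛ)
open import Data.List.Relation.Binary.Permutation.Propositional.Properties using (↭-length; ∈-resp-↭; ∷↭∷ʳ)
import Data.List.Relation.Binary.Permutation.Setoid.Properties as SetoidPermutation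
open import Data.List.Relation.Unary.All as All using ([]; _∷_)
open import Data.List.Relation.Unary.All.Properties using (All¬⇒¬Any)
open import Data.List.Relation.Unary.AllPairs using ([]; _∷_)
open import Data.List.Relation.Unary.Any using (here; there)
open import Data.List.Relation.Unary.Linked using (Linked; []; [-]; _∷_)
open import Data.List.Relation.Unary.Unique.Propositional using (Unique)
import Data.List.Relation.Unary.Unique.Propositional.Properties as Unique
open import Data.Maybe.Base using (just)
open import Data.Maybe.Properties using (just-injective)
import Data.Maybe.Relation.Unary.Any as Maybe
open import Data.Nat.Base
  using (ℕ; zero; suc; _+_; _*_; _^_; _∸_; _≤_; _<_; z≤n; s≤s; _<ᵇ_; ∣_-_∣)
open import Data.Nat.DivMod
  using (_%_; _/_; %-distribˡ-+; m%n%n≡m%n; [m+kn]%n≡m%n; m<n⇒m%n≡m; m%n<n; m≡m%n+[m/n]*n)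
open import Data.Nat.ListAction using (sum)
open import Data.Nat.Properties as ℕ
open import Data.Product.Base using (_×_; _,_; proj₁; proj₂; ∃-syntax)
open import Data.Product.Properties using (≡-dec)
open import Data.Sum.Base as Sum using (_⊎_; inj₁; inj₂; [_,_]′)
open import Data.Unit.Base using (⊤; tt)
open import Function.Base using (_∘_; id)
open import Function.Bundles using (_⇔_; mk⇔; Equivalence)
open import Relation.Binary.Definitions using (Decidable; DecidableEquality)
open import Relation.Binary.PropositionalEquality
open import Relation.Nullary.Decidable using (Dec; yes; no; does; ¬?; _×-dec_; _⊎-dec_)
open import Relation.Nullary.Negation using (¬_; contradiction)

open Equivalence using (to; from)

-- Counting by enumeration

-- The sink gives all tours the same end, so every eliminated vertex lies strictly inside the path
-- and has both neighbours, wherever the tour stops. Forced arcs are all that a state has to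
-- remember: an eliminated stretch of the path contracts to a single arc, so connectivity needs no
-- separate record, and a cycle would have to contract to an arc from a vertex to itself, which is
-- never formed.
--
-- The row of a vertex is determined by its code modulo 5. In positions relative to the window,
-- eliminating a column is therefore one operator `column`, the same for all columns, and a
-- polynomial in `column` that annihilates the starting state yields a recurrence. The states are
-- never listed or bounded; the computation follows those that arise.
--
-- The obstacle is that the denominator, read as such a polynomial, does not annihilate the starting
-- state: it leaves a nonzero formal combination whose values nevertheless vanish beyond the first.
-- A second polynomial annihilates this remainder, and finitely many computed values then settle it.

record Counts {A : Set} (P : A → Set) (n : ℕ) : Set where
  field
    elements : List A
    unique   : Unique elements
    sound    : ∀ {x} → x ∈ elements → P x
    complete : ∀ {x} → P x → x ∈ elements
    size     : length elements ≡ n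

open Counts

private variable
  A B I : Set

-- Two duplicate-free lists with the same members are permutations of each other. This exchanges the
-- enumeration that defines `g` for the recursive count, without evaluating the former.
counts-functional : {P : A → Set} {m n : ℕ} → Counts P m → Counts P n → m ≡ n
counts-functional c d = trans (sym (size c)) (trans (↭-length (∼bag⇒↭
  (unique∧set⇒bag (unique c) (unique d)
    (mk⇔ (complete d ∘ sound c) (complete c ∘ sound d))))) (size d))

counts-cong : {P Q : A → Set} {n : ℕ} → (∀ {x} → P x ⇔ Q x) → Counts P n → Counts Q n
counts-cong P⇔Q c = record
  { elements = elements c
  ; unique   = unique c
  ; sound    = to P⇔Q ∘ sound c
  ; complete = complete c ∘ from P⇔Q
  ; size     = size c
  }

counts-∅ : {P : A → Set} → (∀ {x} → ¬ P x) → Counts P 0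
counts-∅ ¬P = record
  { elements = [] ; unique = [] ; sound = λ () ; complete = λ p → contradiction p ¬P ; size = refl }

counts-singleton : {P : A → Set} {a : A} → P a → (∀ {x} → P x → x ≡ a) → Counts P 1
counts-singleton {P = P} {a} pa P⇒≡ = record
  { elements = a ∷ []
  ; unique   = [] ∷ []
  ; sound    = λ { (here refl) → pa }
  ; complete = here ∘ P⇒≡
  ; size     = refl
  }

counts-⊎ : {P Q : A → Set} {m n : ℕ} → (∀ {x} → P x → ¬ Q x) →
           Counts P m → Counts Q n → Counts (λ x → P x ⊎ Q x) (m + n)
counts-⊎ disjoint c d = record
  { elements = elements c ++ elements d
  ; unique   = Unique.++⁺ (unique c) (unique d) (λ (∈c , ∈d) → disjoint (sound c ∈c) (sound d ∈d))
  ; sound    = λ ∈cd → [ inj₁ ∘ sound c , inj₂ ∘ sound d ]′ (∈-++⁻ (elements c) ∈cd)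
  ; complete = [ ∈-++⁺ˡ ∘ complete c , ∈-++⁺ʳ (elements c) ∘ complete d ]′
  ; size     = trans (List.length-++ (elements c)) (cong₂ _+_ (size c) (size d))
  }

map-unique : {h : A → B} {xs : List A} →
             (∀ {x y} → x ∈ xs → y ∈ xs → h x ≡ h y → x ≡ y) → Unique xs → Unique (map h xs)
map-unique inj [] = []
map-unique {h = h} {x ∷ xs} inj (x≢ ∷ xs!) = All.tabulate fresh ∷ map-unique (λ p q → inj (there p) (there q)) xs!
  where
  fresh : ∀ {y} → y ∈ map h xs → h x ≢ y
  fresh y∈ hx≡y with ∈-map⁻ h y∈
  ... | z , z∈ , refl = All.lookup x≢ z∈ (inj (here refl) (there z∈) hx≡y)

counts-image : {P : A → Set} {n : ℕ} (h : A → B) → (∀ {x y} → P x → P y → h x ≡ h y → x ≡ y) →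
               Counts P n → Counts (λ y → ∃[ x ] P x × y ≡ h x) n
counts-image h inj c = record
  { elements = map h (elements c)
  ; unique   = map-unique (λ p q → inj (sound c p) (sound c q)) (unique c)
  ; sound    = λ y∈ → let x , x∈ , eq = ∈-map⁻ h y∈ in x , sound c x∈ , eq
  ; complete = λ { (x , p , refl) → ∈-map⁺ h (complete c p) }
  ; size     = trans (List.length-map h (elements c)) (size c)
  }

counts-⋃ : {P : I → A → Set} {f : I → ℕ} {is : List I} → Unique is →
           (∀ {i j x} → i ∈ is → j ∈ is → P i x → P j x → i ≡ j) → (∀ {i} → i ∈ is → Counts (P i) (f i)) →
           Counts (λ x → ∃[ i ] i ∈ is × P i x) (sum (map f is))
counts-⋃ {is = []} _ _ _ = counts-∅ λ ()
counts-⋃ {is = i ∷ is} (i≢ ∷ is!) disjoint c = counts-cong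
  (mk⇔ (λ { (inj₁ p) → i , here refl , p ; (inj₂ (j , j∈ , p)) → j , there j∈ , p })
       (λ { (j , here refl , p) → inj₁ p ; (j , there j∈ , p) → inj₂ (j , j∈ , p) }))
  (counts-⊎ (λ p (j , j∈ , q) → All.lookup i≢ j∈ (disjoint (here refl) (there j∈) p q))
    (c (here refl)) (counts-⋃ is! (λ i∈ j∈ → disjoint (there i∈) (there j∈)) (c ∘ there)))

-- Consecutive entries and insertions

data Consecutive {A : Set} (x y : A) : List A → Set where
  here  : ∀ {w} → Consecutive x y (x ∷ y ∷ w)
  there : ∀ {z w} → Consecutive x y w → Consecutive x y (z ∷ w)

data Insertion {A : Set} (a v b : A) : List A → List A → Set where
  here  : ∀ {w} → Insertion a v b (a ∷ b ∷ w) (a ∷ v ∷ b ∷ w)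
  there : ∀ {x w w⁺} → Insertion a v b w w⁺ → Insertion a v b (x ∷ w) (x ∷ w⁺)

module _ {A : Set} where

  private variable
    a a′ b b′ v x x′ y y′ : A
    w w′ w⁺ : List A

  consecutive-∈ˡ : Consecutive x y w → x ∈ w
  consecutive-∈ˡ here      = here refl
  consecutive-∈ˡ (there c) = there (consecutive-∈ˡ c)

  consecutive-∈ʳ : Consecutive x y w → y ∈ w
  consecutive-∈ʳ here      = there (here refl)
  consecutive-∈ʳ (there c) = there (consecutive-∈ʳ c)

  consecutive-≢ : Unique w → Consecutive x y w → x ≢ y
  consecutive-≢ ((x≢y ∷ _) ∷ _) here      = x≢y
  consecutive-≢ (_ ∷ w!)        (there c) = consecutive-≢ w! c

  head∉tail : Unique (x ∷ w) → x ∉ w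
  head∉tail (x≢ ∷ _) = All¬⇒¬Any x≢

  successor-unique : Unique w → Consecutive x y w → Consecutive x y′ w → y ≡ y′
  successor-unique w! here       here       = refl
  successor-unique w! here       (there c′) = contradiction (consecutive-∈ˡ c′) (head∉tail w!)
  successor-unique w! (there c)  here       = contradiction (consecutive-∈ˡ c) (head∉tail w!)
  successor-unique (_ ∷ w!) (there c) (there c′) = successor-unique w! c c′

  predecessor-unique : Unique w → Consecutive x y w → Consecutive x′ y w → x ≡ x′
  predecessor-unique w! here here = refl
  predecessor-unique (_ ∷ w!) here (there (there c′)) = contradiction (consecutive-∈ʳ c′) (head∉tail w!)
  predecessor-unique (_ ∷ w!) here (there here) = contradiction (here refl) (head∉tail w!)
  predecessor-unique (_ ∷ w!) (there (there c)) here = contradiction (consecutive-∈ʳ c) (head∉tail w!)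
  predecessor-unique (_ ∷ w!) (there here) here = contradiction (here refl) (head∉tail w!)
  predecessor-unique (_ ∷ w!) (there c) (there c′) = predecessor-unique w! c c′

  last-∈ : last w ≡ just x → x ∈ w
  last-∈ {w = _ ∷ []}    eq = here (sym (just-injective eq))
  last-∈ {w = _ ∷ _ ∷ _} eq = there (last-∈ eq)

  last-no-successor : Unique w → last w ≡ just x → ¬ Consecutive x y w
  last-no-successor w!       eq here = head∉tail w! (last-∈ eq)
  last-no-successor {w = _ ∷ _ ∷ _} (_ ∷ w!) eq (there c) = last-no-successor w! eq c

  successor-exists : x ∈ w → last w ≢ just x → ∃[ y ] Consecutive x y w
  successor-exists {w = _ ∷ []}    (here refl) ≢last = contradiction refl ≢last
  successor-exists {w = _ ∷ _ ∷ _} (here refl) ≢last = _ , here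
  successor-exists {w = _ ∷ _ ∷ _} (there x∈)  ≢last =
    let y , c = successor-exists x∈ ≢last in y , there c

  insertion-exists : v ∈ w → last (x ∷ w) ≢ just v →
                     ∃[ a ] ∃[ b ] ∃[ w⁻ ] Insertion a v b w⁻ (x ∷ w)
  insertion-exists {w = _ ∷ []}    (here refl) ≢last = contradiction refl ≢last
  insertion-exists {w = _ ∷ _ ∷ _} (here refl) ≢last = _ , _ , _ , here
  insertion-exists {w = _ ∷ _}     (there v∈)  ≢last =
    let a , b , w⁻ , i = insertion-exists v∈ ≢last in a , b , _ , there i

  insertion-head : Insertion a v b w w⁺ → head w ≡ head w⁺
  insertion-head here      = refl
  insertion-head (there _) = refl

  insertion-last : Insertion a v b w w⁺ → last w ≡ last w⁺
  insertion-last here              = refl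
  insertion-last (there here)      = refl
  insertion-last (there (there i)) = insertion-last (there i)

  insertion-↭ : Insertion a v b w w⁺ → w⁺ ↭ v ∷ w
  insertion-↭ here      = swap _ _ ↭-refl
  insertion-↭ (there i) = ↭-trans (prep _ (insertion-↭ i)) (swap _ _ ↭-refl)

  insertion-consecutiveˡ : Insertion a v b w w⁺ → Consecutive a v w⁺
  insertion-consecutiveˡ here      = here
  insertion-consecutiveˡ (there i) = there (insertion-consecutiveˡ i)

  insertion-consecutiveʳ : Insertion a v b w w⁺ → Consecutive v b w⁺
  insertion-consecutiveʳ here      = there here
  insertion-consecutiveʳ (there i) = there (insertion-consecutiveʳ i)

  insertion-consecutive : Insertion a v b w w⁺ → Consecutive a b w
  insertion-consecutive here      = here
  insertion-consecutive (there i) = there (insertion-consecutive i)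

  consecutive-delete : Insertion a v b w w⁺ → Consecutive x y w⁺ →
                       (x ≡ a × y ≡ v) ⊎ (x ≡ v × y ≡ b) ⊎ Consecutive x y w
  consecutive-delete here      here              = inj₁ (refl , refl)
  consecutive-delete here      (there here)      = inj₂ (inj₁ (refl , refl))
  consecutive-delete here      (there (there c)) = inj₂ (inj₂ (there c))
  consecutive-delete (there here)      here = inj₂ (inj₂ here)
  consecutive-delete (there (there _)) here = inj₂ (inj₂ here)
  consecutive-delete (there i) (there c) with consecutive-delete i c
  ... | inj₁ eqs        = inj₁ eqs
  ... | inj₂ (inj₁ eqs) = inj₂ (inj₁ eqs)
  ... | inj₂ (inj₂ c′)  = inj₂ (inj₂ (there c′))

  consecutive-insert : Insertion a v b w w⁺ → Consecutive x y w →
                       (x ≡ a × y ≡ b) ⊎ Consecutive x y w⁺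
  consecutive-insert here here      = inj₁ (refl , refl)
  consecutive-insert here (there c) = inj₂ (there (there c))
  consecutive-insert (there here)      here = inj₂ here
  consecutive-insert (there (there _)) here = inj₂ here
  consecutive-insert (there i) (there c) with consecutive-insert i c
  ... | inj₁ eqs = inj₁ eqs
  ... | inj₂ c′  = inj₂ (there c′)

  insertion-functional : Unique w⁺ → Insertion a v b w w⁺ → Insertion a v b w′ w⁺ → w ≡ w′
  insertion-functional w⁺! here here = refl
  insertion-functional w⁺! here (there i) =
    contradiction (consecutive-∈ˡ (insertion-consecutiveˡ i)) (head∉tail w⁺!)
  insertion-functional w⁺! (there i) here =
    contradiction (consecutive-∈ˡ (insertion-consecutiveˡ i)) (head∉tail w⁺!)
  insertion-functional (_ ∷ w⁺!) (there i) (there i′) = cong (_ ∷_) (insertion-functional w⁺! i i′)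

  insertion-deterministic : Unique w → Insertion a v b w w⁺ → Insertion a v b w w′ → w⁺ ≡ w′
  insertion-deterministic w! here here = refl
  insertion-deterministic w! here (there i) =
    contradiction (consecutive-∈ˡ (insertion-consecutive i)) (head∉tail w!)
  insertion-deterministic w! (there i) here =
    contradiction (consecutive-∈ˡ (insertion-consecutive i)) (head∉tail w!)
  insertion-deterministic (_ ∷ w!) (there i) (there i′) = cong (_ ∷_) (insertion-deterministic w! i i′)

  Unique-tail : Unique (x ∷ w) → Unique w
  Unique-tail (_ ∷ w!) = w!

  Unique-resp-↭ : w ↭ w′ → Unique w → Unique w′
  Unique-resp-↭ p = SetoidPermutation.Unique-resp-↭ (setoid A) (↭⇒↭ₛ p)

  module _ (_≟_ : DecidableEquality A) where

    insertAfter : A → A → List A → List A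
    insertAfter a v []      = []
    insertAfter a v (x ∷ w) with x ≟ a
    ... | yes _ = x ∷ v ∷ w
    ... | no  _ = x ∷ insertAfter a v w

    insertion-insertAfter : Unique w → Consecutive a b w → Insertion a v b w (insertAfter a v w)
    insertion-insertAfter {a = a} w! here with a ≟ a
    ... | yes _   = here
    ... | no  a≢a = contradiction refl a≢a
    insertion-insertAfter {w = x ∷ w} {a = a} w!@(_ ∷ w!′) (there c) with x ≟ a
    ... | yes refl = contradiction (consecutive-∈ˡ c) (head∉tail w!)
    ... | no  _    = there (insertion-insertAfter w!′ c)

-- Elimination of a vertex from a Hamiltonian path

record HamiltonianPath {A : Set} (V : A → Set) (R : A → A → Set) (s t : A) (w : List A) : Set where
  field
    starts : head w ≡ just s
    ends   : last w ≡ just t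
    simple : Unique w
    arcs   : ∀ {x y} → Consecutive x y w → R x y
    covers : ∀ {x} → x ∈ w ⇔ V x

open HamiltonianPath

hamiltonianPath-cong : ∀ {V V′ : A → Set} {R R′ : A → A → Set} {s t w} →
  (∀ {x} → V x ⇔ V′ x) → (∀ {x y} → V x → V y → R x y → R′ x y) →
  HamiltonianPath V R s t w → HamiltonianPath V′ R′ s t w
hamiltonianPath-cong V⇔V′ R⇒R′ p = record
  { starts = starts p
  ; ends   = ends p
  ; simple = simple p
  ; arcs   = λ c → R⇒R′ (to (covers p) (consecutive-∈ˡ c)) (to (covers p) (consecutive-∈ʳ c)) (arcs p c)
  ; covers = mk⇔ (to V⇔V′ ∘ to (covers p)) (from (covers p) ∘ from V⇔V′)
  }

-- The arc from `a` to `b` stands for the route through the eliminated vertex. Deleting its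
-- competitors, rather than demanding the arc separately, keeps the condition on paths a relation
-- between consecutive entries.
Force : (A → A → Set) → A → A → A → A → Set
Force R a b x y = (x ≡ a × y ≡ b) ⊎ (x ≢ a × y ≢ b × R x y)

module _ {A : Set} (_≟_ : DecidableEquality A)
         {V : A → Set} {R : A → A → Set} {s t v : A} (v∈V : V v) (v≢s : v ≢ s) (v≢t : v ≢ t)
         where

  private
    V⁻ : A → Set
    V⁻ x = V x × x ≢ v

  -- A Hamiltonian path for Force R a b uses the arc from a to b, as no other arc leaves a.
  forced-consecutive : ∀ {a b w} → V⁻ a → a ≢ t → HamiltonianPath V⁻ (Force R a b) s t w →
                       Consecutive a b w
  forced-consecutive a∈V a≢t p
    with successor-exists (from (covers p) a∈V) (λ eq → a≢t (just-injective (trans (sym eq) (ends p))))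
  ... | y , c with arcs p c
  ...   | inj₁ (_ , refl)   = c
  ...   | inj₂ (a≢a , _) = contradiction refl a≢a

  subdivide : ∀ {a b w w⁺} → R a v → R v b → Insertion a v b w w⁺ →
              HamiltonianPath V⁻ (Force R a b) s t w → HamiltonianPath V R s t w⁺
  subdivide {a} {b} {w} {w⁺} av vb i p = record
    { starts = trans (sym (insertion-head i)) (starts p)
    ; ends   = trans (sym (insertion-last i)) (ends p)
    ; simple = w⁺!
    ; arcs   = arcs′
    ; covers = mk⇔ V-w⁺ w⁺-V
    }
    where
    v∉w : v ∉ w
    v∉w v∈w = proj₂ (to (covers p) v∈w) refl
    w⁺! : Unique w⁺
    w⁺! = Unique-resp-↭ (↭-sym (insertion-↭ i))
            (All.tabulate (λ { x∈w refl → v∉w x∈w }) ∷ simple p)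
    V-w⁺ : ∀ {x} → x ∈ w⁺ → V x
    V-w⁺ x∈w⁺ with ∈-resp-↭ (insertion-↭ i) x∈w⁺
    ... | here refl = v∈V
    ... | there x∈w = proj₁ (to (covers p) x∈w)
    w⁺-V : ∀ {x} → V x → x ∈ w⁺
    w⁺-V {x} x∈V with x ≟ v
    ... | yes refl = ∈-resp-↭ (↭-sym (insertion-↭ i)) (here refl)
    ... | no  x≢v  = ∈-resp-↭ (↭-sym (insertion-↭ i)) (there (from (covers p) (x∈V , x≢v)))
    arcs′ : ∀ {x y} → Consecutive x y w⁺ → R x y
    arcs′ c with consecutive-delete i c
    ... | inj₁ (refl , refl)        = av
    ... | inj₂ (inj₁ (refl , refl)) = vb
    ... | inj₂ (inj₂ c′) with arcs p c′
    ...   | inj₂ (_ , _ , r) = r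
    -- The forced arc need not belong to `R`, but it does not survive the insertion: the successor
    -- of `a` in `w⁺` is `v`.
    ...   | inj₁ (refl , refl) = contradiction
      (subst (_∈ w) (successor-unique w⁺! c (insertion-consecutiveˡ i)) (consecutive-∈ʳ c′)) v∉w

  shortcut : ∀ {w⁺} → HamiltonianPath V R s t w⁺ →
    ∃[ a ] ∃[ b ] ∃[ w ] Insertion a v b w w⁺ × V⁻ a × V⁻ b × a ≢ t × a ≢ b ×
      R a v × R v b × HamiltonianPath V⁻ (Force R a b) s t w
  shortcut {w⁺} p with w⁺ | from (covers p) v∈V | p
  ... | _ ∷ _ | here refl  | p = contradiction (just-injective (starts p)) v≢s
  ... | w⁺    | there v∈w⁺ | p
    with a , b , w , i ← insertion-exists v∈w⁺ (λ eq → v≢t (just-injective (trans (sym eq) (ends p))))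
    = a , b , w , i , V⁻-w (consecutive-∈ˡ ab) , V⁻-w (consecutive-∈ʳ ab)
    , (λ { refl → last-no-successor (simple p) (ends p) av }) , consecutive-≢ w! ab
    , arcs p av , arcs p vb
    , record
      { starts = trans (insertion-head i) (starts p)
      ; ends   = trans (insertion-last i) (ends p)
      ; simple = w!
      ; arcs   = arcs′
      ; covers = mk⇔ V⁻-w w-V⁻
      }
    where
    ab : Consecutive a b w
    ab = insertion-consecutive i
    av : Consecutive a v w⁺
    av = insertion-consecutiveˡ i
    vb : Consecutive v b w⁺
    vb = insertion-consecutiveʳ i
    vw! : Unique (v ∷ w)
    vw! = Unique-resp-↭ (insertion-↭ i) (simple p)
    w! : Unique w
    w! = Unique-tail vw!
    v∉w : v ∉ w
    v∉w = head∉tail vw!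
    V⁻-w : ∀ {x} → x ∈ w → V⁻ x
    V⁻-w x∈w = to (covers p) (∈-resp-↭ (↭-sym (insertion-↭ i)) (there x∈w)) , λ { refl → v∉w x∈w }
    w-V⁻ : ∀ {x} → V⁻ x → x ∈ w
    w-V⁻ (x∈V , x≢v) with ∈-resp-↭ (insertion-↭ i) (from (covers p) x∈V)
    ... | here refl = contradiction refl x≢v
    ... | there x∈w = x∈w
    arcs′ : ∀ {x y} → Consecutive x y w → Force R a b x y
    arcs′ c with consecutive-insert i c
    ... | inj₁ eqs = inj₁ eqs
    ... | inj₂ c⁺  = inj₂
      -- In `w⁺` the successor of `a` and the predecessor of `b` are `v`, so no arc kept from `w⁺`
      -- competes with the forced one.
      ( (λ { refl → v∉w (subst (_∈ w) (successor-unique (simple p) c⁺ av) (consecutive-∈ʳ c)) })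
      , (λ { refl → v∉w (subst (_∈ w) (predecessor-unique (simple p) c⁺ vb) (consecutive-∈ˡ c)) })
      , arcs p c⁺ )

  -- The classes are disjoint because a path determines the predecessor and the successor of `v`. An
  -- index has to satisfy local conditions only; if no path passes that way, its term is 0.
  counts-eliminate : ∀ {I : Set} {is : List I} {a b : I → A} {f : I → ℕ} → Unique is →
    (∀ {i j} → a i ≡ a j → b i ≡ b j → i ≡ j) →
    (∀ {i} → i ∈ is → V⁻ (a i) × a i ≢ t × R (a i) v × R v (b i)) →
    (∀ {x y} → V⁻ x → V⁻ y → x ≢ t → x ≢ y → R x v → R v y → ∃[ i ] i ∈ is × a i ≡ x × b i ≡ y) →
    (∀ {i} → i ∈ is → Counts (HamiltonianPath V⁻ (Force R (a i) (b i)) s t) (f i)) →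
    Counts (HamiltonianPath V R s t) (sum (map f is))
  counts-eliminate {I} {is} {a} {b} is! injective sound complete c = counts-cong (mk⇔ glue cut)
    (counts-⋃ is!
      (λ i∈ j∈ (_ , p , w⁺≡ᵢ) (_ , q , w⁺≡ⱼ) → injective
        (predecessor-unique (w⁺! i∈ p w⁺≡ᵢ)
          (insertion-consecutiveˡ (inserted i∈ p w⁺≡ᵢ)) (insertion-consecutiveˡ (inserted j∈ q w⁺≡ⱼ)))
        (successor-unique (w⁺! i∈ p w⁺≡ᵢ)
          (insertion-consecutiveʳ (inserted i∈ p w⁺≡ᵢ)) (insertion-consecutiveʳ (inserted j∈ q w⁺≡ⱼ))))
      (λ i∈ → counts-image (insertAfter _≟_ (a _) v)
        (λ p q eq → insertion-functional (w⁺! i∈ p refl) (inserted i∈ p refl) (inserted i∈ q eq)) (c i∈)))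
    where
    Path⁻ : I → List A → Set
    Path⁻ i = HamiltonianPath V⁻ (Force R (a i) (b i)) s t
    inserted : ∀ {i w w⁺} → i ∈ is → Path⁻ i w → w⁺ ≡ insertAfter _≟_ (a i) v w → Insertion (a i) v (b i) w w⁺
    inserted i∈ p refl = let ai∈V , ai≢t , _ = sound i∈ in
      insertion-insertAfter _≟_ (simple p) (forced-consecutive ai∈V ai≢t p)
    glued : ∀ {i w w⁺} → i ∈ is → Path⁻ i w → w⁺ ≡ insertAfter _≟_ (a i) v w → HamiltonianPath V R s t w⁺
    glued i∈ p eq = let _ , _ , av , vb = sound i∈ in subdivide av vb (inserted i∈ p eq) p
    w⁺! : ∀ {i w w⁺} → i ∈ is → Path⁻ i w → w⁺ ≡ insertAfter _≟_ (a i) v w → Unique w⁺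
    w⁺! i∈ p eq = simple (glued i∈ p eq)
    glue : ∀ {w⁺} → ∃[ i ] i ∈ is × (∃[ w ] Path⁻ i w × w⁺ ≡ insertAfter _≟_ (a i) v w) →
           HamiltonianPath V R s t w⁺
    glue (i , i∈ , w , p , eq) = glued i∈ p eq
    cut : ∀ {w⁺} → HamiltonianPath V R s t w⁺ →
          ∃[ i ] i ∈ is × (∃[ w ] Path⁻ i w × w⁺ ≡ insertAfter _≟_ (a i) v w)
    cut p with shortcut p
    ... | _ , _ , w , ins , a∈V , b∈V , a≢t , a≢b , av , vb , q
      with i , i∈ , refl , refl ← complete a∈V b∈V a≢t a≢b av vb
      = i , i∈ , w , q , insertion-deterministic (simple q) ins (inserted i∈ q refl)

-- Arcs between codes

-- Code 0 is the sink, and 1 + (5 c + i) is the vertex in row i and column c.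
-- The arguments of Next r are relative to an offset congruent to r modulo 5.
Next : ℕ → ℕ → ℕ → Set
Next r x y = y ≡ 5 + x ⊎ (y ≡ suc x × (r + x) % 5 ≢ 0)

Arc : ℕ → ℕ → ℕ → Set
Arc r zero    y       = ⊥
Arc r (suc x) zero    = ⊤
Arc r (suc x) (suc y) = Next r (suc x) (suc y) ⊎ Next r (suc y) (suc x)

next? : ∀ r → Decidable (Next r)
next? r x y = y ≟ 5 + x ⊎-dec (y ≟ suc x ×-dec ¬? ((r + x) % 5 ≟ 0))

arc? : ∀ r → Decidable (Arc r)
arc? r zero    y       = no λ ()
arc? r (suc x) zero    = yes tt
arc? r (suc x) (suc y) = next? r (suc x) (suc y) ⊎-dec next? r (suc y) (suc x)

-- Forced arcs

Links : Set
Links = List (ℕ × ℕ)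

open DecMembership (≡-dec _≟_ _≟_) using () renaming (_∈?_ to _∈ᴸ?_)
open DecMembership _≟_ using (_∉?_)

-- What iterating `Force` amounts to when the links form a partial injection.
Allowed : ℕ → Links → ℕ → ℕ → Set
Allowed r L x y = (x , y) ∈ L ⊎ (Arc r x y × x ∉ map proj₁ L × y ∉ map proj₂ L)

allowed? : ∀ r L → Decidable (Allowed r L)
allowed? r L x y = ((x , y) ∈ᴸ? L) ⊎-dec (arc? r x y ×-dec (x ∉? map proj₁ L) ×-dec (y ∉? map proj₂ L))

avoiding : ℕ → Links → Links
avoiding v = filter (λ (a , b) → ¬? (a ≟ v) ×-dec ¬? (b ≟ v))

-- Links are kept sorted by source so that equal sets of links are equal lists.
link : ℕ × ℕ → Links → Links
link e [] = e ∷ []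
link e (e′ ∷ L) = if proj₁ e <ᵇ proj₁ e′ then e ∷ e′ ∷ L else e′ ∷ link e L

-- The path ends at the sink 0, so nothing follows it; `a` equal to `b` would close a cycle through
-- `v`.
candidates : ℕ → ℕ → Links → Links
candidates r v L = filter (λ (a , b) → ¬? (a ≟ 0) ×-dec ¬? (a ≟ b))
  (cartesianProduct (filter (λ a → allowed? r L a v) (upTo v)) (filter (allowed? r L v) (upTo v)))

eliminate : ℕ → ℕ → Links → List Links
eliminate r v L = map (λ e → link e (avoiding v L)) (candidates r v L)

link-↭ : ∀ e L → link e L ↭ e ∷ L
link-↭ e [] = ↭-refl
link-↭ e (e′ ∷ L) with proj₁ e <ᵇ proj₁ e′
... | true  = ↭-refl
... | false = ↭-trans (prep e′ (link-↭ e L)) (swap e′ e ↭-refl)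

PartialInjection : Links → Set
PartialInjection L = (∀ {x y y′} → (x , y) ∈ L → (x , y′) ∈ L → y ≡ y′)
                   × (∀ {x x′ y} → (x , y) ∈ L → (x′ , y) ∈ L → x ≡ x′)

module _ {L : Links} where

  source⁺ : ∀ {x y} → (x , y) ∈ L → x ∈ map proj₁ L
  source⁺ = ∈-map⁺ proj₁

  source⁻ : ∀ {x} → x ∈ map proj₁ L → ∃[ y ] (x , y) ∈ L
  source⁻ x∈ with (_ , y) , xy∈ , refl ← ∈-map⁻ proj₁ x∈ = y , xy∈

  target⁺ : ∀ {x y} → (x , y) ∈ L → y ∈ map proj₂ L
  target⁺ = ∈-map⁺ proj₂

  target⁻ : ∀ {y} → y ∈ map proj₂ L → ∃[ x ] (x , y) ∈ L
  target⁻ y∈ with (x , _) , xy∈ , refl ← ∈-map⁻ proj₂ y∈ = x , xy∈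

  ∈-avoiding⁺ : ∀ {v x y} → (x , y) ∈ L → x ≢ v → y ≢ v → (x , y) ∈ avoiding v L
  ∈-avoiding⁺ xy∈ x≢v y≢v = ∈-filter⁺ _ xy∈ (x≢v , y≢v)

  ∈-avoiding⁻ : ∀ {v x y} → (x , y) ∈ avoiding v L → (x , y) ∈ L × x ≢ v × y ≢ v
  ∈-avoiding⁻ = ∈-filter⁻ _ {xs = L}

allowed-cong : ∀ {r L L′ x y} → (∀ {e} → e ∈ L ⇔ e ∈ L′) → Allowed r L x y → Allowed r L′ x y
allowed-cong L⇔L′ (inj₁ xy∈) = inj₁ (to L⇔L′ xy∈)
allowed-cong L⇔L′ (inj₂ (arc , x∉ , y∉)) = inj₂ (arc
  , (λ x∈ → x∉ (source⁺ (from L⇔L′ (proj₂ (source⁻ x∈)))))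
  , (λ y∈ → y∉ (target⁺ (from L⇔L′ (proj₂ (target⁻ y∈))))))

partialInjection-cong : ∀ {L L′} → (∀ {e} → e ∈ L ⇔ e ∈ L′) → PartialInjection L → PartialInjection L′
partialInjection-cong L⇔L′ (functional , injective) =
  (λ p q → functional (from L⇔L′ p) (from L⇔L′ q)) , (λ p q → injective (from L⇔L′ p) (from L⇔L′ q))

module _ {r L a b v} (pi : PartialInjection L) (av : Allowed r L a v) (vb : Allowed r L v b) where

  private
    functional : ∀ {x y y′} → (x , y) ∈ L → (x , y′) ∈ L → y ≡ y′
    functional = proj₁ pi
    injective : ∀ {x x′ y} → (x , y) ∈ L → (x′ , y) ∈ L → x ≡ x′
    injective = proj₂ pi

    -- The arc from `a` to `v` is allowed, so a link leaving `a` must be that very arc; otherwise it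
    -- would block it. The next three facts are its mirror images.
    a-link : ∀ {y} → (a , y) ∈ L → y ≡ v
    a-link ay∈ = [ (λ av∈ → functional ay∈ av∈) , (λ (_ , a∉ , _) → contradiction (source⁺ ay∈) a∉) ]′ av

    b-link : ∀ {x} → (x , b) ∈ L → x ≡ v
    b-link xb∈ = [ (λ vb∈ → injective xb∈ vb∈) , (λ (_ , _ , b∉) → contradiction (target⁺ xb∈) b∉) ]′ vb

    link-v : ∀ {x} → (x , v) ∈ L → x ≡ a
    link-v xv∈ = [ (λ av∈ → injective xv∈ av∈) , (λ (_ , _ , v∉) → contradiction (target⁺ xv∈) v∉) ]′ av

    v-link : ∀ {y} → (v , y) ∈ L → y ≡ b
    v-link vy∈ = [ (λ vb∈ → functional vy∈ vb∈) , (λ (_ , v∉ , _) → contradiction (source⁺ vy∈) v∉) ]′ vb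

  force⇒allowed : ∀ {x y} → x ≢ v → y ≢ v →
                  Force (Allowed r L) a b x y → Allowed r ((a , b) ∷ avoiding v L) x y
  force⇒allowed x≢v y≢v (inj₁ (refl , refl)) = inj₁ (here refl)
  force⇒allowed x≢v y≢v (inj₂ (_ , _ , inj₁ xy∈)) = inj₁ (there (∈-avoiding⁺ xy∈ x≢v y≢v))
  force⇒allowed x≢v y≢v (inj₂ (x≢a , y≢b , inj₂ (arc , x∉ , y∉))) = inj₂ (arc
    , (λ { (here x≡a) → x≢a x≡a ; (there x∈) → x∉ (source⁺ (proj₁ (∈-avoiding⁻ (proj₂ (source⁻ x∈))))) })
    , (λ { (here y≡b) → y≢b y≡b ; (there y∈) → y∉ (target⁺ (proj₁ (∈-avoiding⁻ (proj₂ (target⁻ y∈))))) }))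

  allowed⇒force : ∀ {x y} → x ≢ v → y ≢ v →
                  Allowed r ((a , b) ∷ avoiding v L) x y → Force (Allowed r L) a b x y
  allowed⇒force x≢v y≢v (inj₁ (here refl)) = inj₁ (refl , refl)
  allowed⇒force x≢v y≢v (inj₁ (there xy∈′)) with xy∈ , _ ← ∈-avoiding⁻ {L = L} xy∈′ =
    inj₂ ((λ { refl → y≢v (a-link xy∈) }) , (λ { refl → x≢v (b-link xy∈) }) , inj₁ xy∈)
  allowed⇒force {x} {y} x≢v y≢v (inj₂ (arc , x∉ , y∉)) =
    inj₂ (x≢a , y≢b , inj₂ (arc
      -- A link from `x` that `avoiding v` removes must end in `v`, and then `x` is `a`.
      , (λ x∈ → let z , xz∈ = source⁻ x∈ in x∉ (there (source⁺
          (∈-avoiding⁺ xz∈ x≢v λ { refl → x≢a (link-v xz∈) }))))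
      , (λ y∈ → let z , zy∈ = target⁻ y∈ in y∉ (there (target⁺
          (∈-avoiding⁺ zy∈ (λ { refl → y≢b (v-link zy∈) }) y≢v))))))
    where
    x≢a : x ≢ a
    x≢a = x∉ ∘ here
    y≢b : y ≢ b
    y≢b = y∉ ∘ here

  partialInjection-force : PartialInjection ((a , b) ∷ avoiding v L)
  partialInjection-force = functional′ , injective′
    where
    functional′ : ∀ {x y y′} → (x , y) ∈ (a , b) ∷ avoiding v L → (x , y′) ∈ (a , b) ∷ avoiding v L → y ≡ y′
    functional′ (here refl) (here refl) = refl
    functional′ (here refl) (there q) = let q∈ , _ , y′≢v = ∈-avoiding⁻ {L = L} q in contradiction (a-link q∈) y′≢v
    functional′ (there p) (here refl) = let p∈ , _ , y≢v = ∈-avoiding⁻ {L = L} p in contradiction (a-link p∈) y≢v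
    functional′ (there p) (there q) = functional (proj₁ (∈-avoiding⁻ p)) (proj₁ (∈-avoiding⁻ q))
    injective′ : ∀ {x x′ y} → (x , y) ∈ (a , b) ∷ avoiding v L → (x′ , y) ∈ (a , b) ∷ avoiding v L → x ≡ x′
    injective′ (here refl) (here refl) = refl
    injective′ (here refl) (there q) = let q∈ , x′≢v , _ = ∈-avoiding⁻ {L = L} q in contradiction (b-link q∈) x′≢v
    injective′ (there p) (here refl) = let p∈ , x≢v , _ = ∈-avoiding⁻ {L = L} p in contradiction (b-link p∈) x≢v
    injective′ (there p) (there q) = injective (proj₁ (∈-avoiding⁻ p)) (proj₁ (∈-avoiding⁻ q))

-- The sliding window

-- The sink is position 0 of every window, whatever its offset j.
place : ℕ → ℕ → ℕ
place j zero    = zero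
place j (suc p) = suc (j + p)

placeLink : ℕ → ℕ × ℕ → ℕ × ℕ
placeLink j (a , b) = place j a , place j b

place-injective : ∀ j {p q} → place j p ≡ place j q → p ≡ q
place-injective j {zero}  {zero}  eq = refl
place-injective j {suc p} {suc q} eq = cong suc (+-cancelˡ-≡ j p q (suc-injective eq))

placeLink-injective : ∀ j {e e′} → placeLink j e ≡ placeLink j e′ → e ≡ e′
placeLink-injective j eq = cong₂ _,_ (place-injective j (cong proj₁ eq)) (place-injective j (cong proj₂ eq))

place-≤ : ∀ j {p v} → p ≤ v → place j p ≤ j + v
place-≤ j {zero}  _   = z≤n
place-≤ j {suc p} p<v = ≤-trans (≤-reflexive (sym (+-suc j p))) (+-monoʳ-≤ j p<v)

place-≤⁻ : ∀ j {p v} → place j p ≤ j + v → p ≤ v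
place-≤⁻ j {zero}  _ = z≤n
place-≤⁻ j {suc p} le = +-cancelˡ-≤ j _ _ (≤-trans (≤-reflexive (+-suc j p)) le)

-- Moves to the right are invariant under translation, and the foot of a column is recognised modulo
-- 5, so adjacency within a window depends on the offset only through `j % 5`.
next-place : ∀ j {p q} → Next (j % 5) (suc p) (suc q) ⇔ Next 0 (place j (suc p)) (place j (suc q))
next-place j {p} {q} = mk⇔
  (Sum.map (λ eq → trans (cong (λ x → suc (j + x)) (suc-injective eq)) (cong suc 5+))
           (λ (eq , r≢0) → trans (cong (λ x → suc (j + x)) (suc-injective eq)) (cong suc (+-suc j p))
                         , r≢0 ∘ trans residue))
  (Sum.map (λ eq → cong suc (+-cancelˡ-≡ j q (5 + p) (trans (suc-injective eq) (sym 5+))))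
           (λ (eq , r≢0) → cong suc (+-cancelˡ-≡ j q (suc p) (trans (suc-injective eq) (sym (+-suc j p))))
                         , r≢0 ∘ trans (sym residue)))
  where
  5+ : j + (5 + p) ≡ 5 + (j + p)
  5+ = trans (sym (+-assoc j 5 p)) (trans (cong (_+ p) (+-comm j 5)) (+-assoc 5 j p))
  residue : (j % 5 + suc p) % 5 ≡ suc (j + p) % 5
  residue = begin
    (j % 5 + suc p) % 5         ≡⟨ %-distribˡ-+ (j % 5) (suc p) 5 ⟩
    (j % 5 % 5 + suc p % 5) % 5 ≡⟨ cong (λ x → (x + suc p % 5) % 5) (m%n%n≡m%n j 5) ⟩
    (j % 5 + suc p % 5) % 5     ≡⟨ %-distribˡ-+ j (suc p) 5 ⟨
    (j + suc p) % 5             ≡⟨ cong (_% 5) (+-suc j p) ⟩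
    suc (j + p) % 5             ∎
    where open ≡-Reasoning

arc-place : ∀ j {p q} → Arc (j % 5) p q ⇔ Arc 0 (place j p) (place j q)
arc-place j {zero}          = mk⇔ id id
arc-place j {suc p} {zero}  = mk⇔ id id
arc-place j {suc p} {suc q} = mk⇔ (Sum.map (to (next-place j)) (to (next-place j)))
                                  (Sum.map (from (next-place j)) (from (next-place j)))

module _ (j : ℕ) {L : Links} where

  ∈-place⁺ : ∀ {p q} → (p , q) ∈ L → (place j p , place j q) ∈ map (placeLink j) L
  ∈-place⁺ = ∈-map⁺ (placeLink j)

  ∈-place⁻ : ∀ {e} → placeLink j e ∈ map (placeLink j) L → e ∈ L
  ∈-place⁻ e∈ with e′ , e′∈ , eq ← ∈-map⁻ (placeLink j) e∈ = subst (_∈ L) (sym (placeLink-injective j eq)) e′∈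

  allowed-place⁺ : ∀ {p q} → Allowed (j % 5) L p q → Allowed 0 (map (placeLink j) L) (place j p) (place j q)
  allowed-place⁺ (inj₁ pq∈) = inj₁ (∈-place⁺ pq∈)
  allowed-place⁺ {p} {q} (inj₂ (arc , p∉ , q∉)) = inj₂ (to (arc-place j) arc , p∉′ , q∉′)
    where
    p∉′ : place j p ∉ map proj₁ (map (placeLink j) L)
    p∉′ p∈ with _ , e∈ ← source⁻ p∈ with (_ , y) , e∈L , eq ← ∈-map⁻ (placeLink j) e∈
      = p∉ (source⁺ (subst (λ x → (x , y) ∈ L) (sym (place-injective j (cong proj₁ eq))) e∈L))
    q∉′ : place j q ∉ map proj₂ (map (placeLink j) L)
    q∉′ q∈ with _ , e∈ ← target⁻ q∈ with (x , _) , e∈L , eq ← ∈-map⁻ (placeLink j) e∈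
      = q∉ (target⁺ (subst (λ y → (x , y) ∈ L) (sym (place-injective j (cong proj₂ eq))) e∈L))

  allowed-place⁻ : ∀ {p q} → Allowed 0 (map (placeLink j) L) (place j p) (place j q) → Allowed (j % 5) L p q
  allowed-place⁻ (inj₁ pq∈) = inj₁ (∈-place⁻ pq∈)
  allowed-place⁻ (inj₂ (arc , p∉ , q∉)) = inj₂ (from (arc-place j) arc
    , (λ p∈ → p∉ (source⁺ (∈-place⁺ (proj₂ (source⁻ p∈)))))
    , (λ q∈ → q∉ (target⁺ (∈-place⁺ (proj₂ (target⁻ q∈))))))

-- Hamiltonian paths from the corner to the sink

Paths : ℕ → Links → List ℕ → Set
Paths n L = HamiltonianPath (_≤ n) (Allowed 0 L) 1 0

-- The remaining grid neighbours of the vertex about to go lie in the window. This makes the search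
-- of `candidates` through window positions exhaustive.
Local : ℕ → ℕ → Set
Local j v = ∀ {x} → Next 0 x (suc (j + v)) → x ≤ j + v → ∃[ p ] x ≡ place j p

next-< : ∀ {r m x} → Next r (suc m) x → m < x
next-< (inj₁ refl)       = m≤n+m _ 5
next-< (inj₂ (refl , _)) = n≤1+n _

unlinked-arc : ∀ {j v x} → Local j v → x ≤ j + v →
               Arc 0 x (suc (j + v)) ⊎ Arc 0 (suc (j + v)) x → ∃[ p ] x ≡ place j p
unlinked-arc {x = zero} _ _ _ = 0 , refl
unlinked-arc {j} {v} {suc x} local x≤ (inj₁ (inj₁ next)) = local next x≤
unlinked-arc {j} {v} {suc x} local x≤ (inj₂ (inj₂ next)) = local next x≤
unlinked-arc {j} {v} {suc x} local x≤ (inj₁ (inj₂ next)) = contradiction x≤ (<⇒≱ (next-< {0} next))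
unlinked-arc {j} {v} {suc x} local x≤ (inj₂ (inj₁ next)) = contradiction x≤ (<⇒≱ (next-< {0} next))

module _ (j : ℕ) {v : ℕ} {L : Links} (local : Local j v) where

  private
    top : ℕ
    top = suc (j + v)
    L↑ : Links
    L↑ = map (placeLink j) L

  in-window : ∀ {x} → x ≤ j + v → Allowed 0 L↑ x top ⊎ Allowed 0 L↑ top x → ∃[ p ] x ≡ place j p
  in-window x≤ (inj₁ (inj₁ e∈)) with (p , _) , _ , eq ← ∈-map⁻ (placeLink j) e∈ = p , cong proj₁ eq
  in-window x≤ (inj₂ (inj₁ e∈)) with (_ , p) , _ , eq ← ∈-map⁻ (placeLink j) e∈ = p , cong proj₂ eq
  in-window x≤ (inj₁ (inj₂ (arc , _))) = unlinked-arc local x≤ (inj₁ arc)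
  in-window x≤ (inj₂ (inj₂ (arc , _))) = unlinked-arc local x≤ (inj₂ arc)

module _ {r v : ℕ} {L : Links} where

  private
    sources targets : List ℕ
    sources = filter (λ a → allowed? r L a v) (upTo v)
    targets = filter (allowed? r L v) (upTo v)

  candidates-unique : Unique (candidates r v L)
  candidates-unique = Unique.filter⁺ _ (Unique.cartesianProduct⁺
    (Unique.filter⁺ _ (Unique.upTo⁺ v)) (Unique.filter⁺ _ (Unique.upTo⁺ v)))

  ∈-candidates⁻ : ∀ {a b} → (a , b) ∈ candidates r v L →
                  a ≢ 0 × a ≢ b × a < v × b < v × Allowed r L a v × Allowed r L v b
  ∈-candidates⁻ ab∈
    with ab∈′ , a≢0 , a≢b ← ∈-filter⁻ _ {xs = cartesianProduct sources targets} ab∈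
    with a∈ , b∈ ← ∈-cartesianProduct⁻ sources targets ab∈′
    with a<v , av ← ∈-filter⁻ (λ a → allowed? r L a v) {xs = upTo v} a∈
    with b<v , vb ← ∈-filter⁻ (allowed? r L v) {xs = upTo v} b∈
    = a≢0 , a≢b , ∈-upTo⁻ a<v , ∈-upTo⁻ b<v , av , vb

  ∈-candidates⁺ : ∀ {a b} → a ≢ 0 → a ≢ b → a < v → b < v → Allowed r L a v → Allowed r L v b →
                  (a , b) ∈ candidates r v L
  ∈-candidates⁺ a≢0 a≢b a<v b<v av vb = ∈-filter⁺ _ (∈-cartesianProduct⁺
    (∈-filter⁺ (λ a → allowed? r L a v) (∈-upTo⁺ a<v) av)
    (∈-filter⁺ (allowed? r L v) (∈-upTo⁺ b<v) vb)) (a≢0 , a≢b)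

-- Only membership among the links affects which arcs are allowed, so sorted insertion at relative
-- positions may replace adding a link to the absolute codes.
link-place : ∀ j {v a b L e} →
  e ∈ (place j a , place j b) ∷ avoiding (suc (j + v)) (map (placeLink j) L) ⇔
  e ∈ map (placeLink j) (link (a , b) (avoiding (suc v) L))
link-place j {v} {a} {b} {L} = mk⇔ into out-of
  where
  into : ∀ {e} → e ∈ (place j a , place j b) ∷ avoiding (suc (j + v)) (map (placeLink j) L) →
           e ∈ map (placeLink j) (link (a , b) (avoiding (suc v) L))
  into (here refl) = ∈-map⁺ (placeLink j) (∈-resp-↭ (↭-sym (link-↭ (a , b) (avoiding (suc v) L))) (here refl))
  into (there e∈)
    with e∈′ , x≢ , y≢ ← ∈-avoiding⁻ {L = map (placeLink j) L} e∈
    with _ , pq∈ , refl ← ∈-map⁻ (placeLink j) e∈′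
    = ∈-map⁺ (placeLink j) (∈-resp-↭ (↭-sym (link-↭ (a , b) (avoiding (suc v) L)))
        (there (∈-avoiding⁺ pq∈ (λ { refl → x≢ refl }) (λ { refl → y≢ refl }))))
  out-of : ∀ {e} → e ∈ map (placeLink j) (link (a , b) (avoiding (suc v) L)) →
         e ∈ (place j a , place j b) ∷ avoiding (suc (j + v)) (map (placeLink j) L)
  out-of e∈ with pq , pq∈ , refl ← ∈-map⁻ (placeLink j) e∈
          with ∈-resp-↭ (link-↭ (a , b) (avoiding (suc v) L)) pq∈
  ... | here refl = here refl
  ... | there pq∈′ with pq∈L , p≢ , q≢ ← ∈-avoiding⁻ {L = L} pq∈′ =
    there (∈-avoiding⁺ (∈-map⁺ (placeLink j) pq∈L)
      (p≢ ∘ place-injective j {q = suc v}) (q≢ ∘ place-injective j {q = suc v}))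

-- The partial injection is carried along because it makes `Force` and the updated list of links
-- permit the same arcs; `partialInjection-force` hands it on to each new list.
eliminate-counts : ∀ j {v L} {f : Links → ℕ} → 1 ≤ v → Local j v → PartialInjection (map (placeLink j) L) →
  (∀ {L′} → PartialInjection (map (placeLink j) L′) → Counts (Paths (j + v) (map (placeLink j) L′)) (f L′)) →
  Counts (Paths (suc (j + v)) (map (placeLink j) L)) (sum (map f (eliminate (j % 5) (suc v) L)))
eliminate-counts j {v} {L} {f} 1≤v local pi c = subst (Counts _)
  (cong sum (List.map-∘ (candidates (j % 5) (suc v) L)))
  (counts-eliminate _≟_ ≤-refl (≢-sym (<⇒≢ (s≤s (≤-trans 1≤v (m≤n+m v j))))) (λ ())
    (candidates-unique {j % 5} {suc v} {L})
    (λ eq eq′ → cong₂ _,_ (place-injective j eq) (place-injective j eq′))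
    candidate-sound candidate-complete forced)
  where
  L↑ : Links
  L↑ = map (placeLink j) L
  top : ℕ
  top = suc (j + v)
  candidate-sound : ∀ {e} → e ∈ candidates (j % 5) (suc v) L →
          (place j (proj₁ e) ≤ top × place j (proj₁ e) ≢ top) × place j (proj₁ e) ≢ 0 ×
          Allowed 0 L↑ (place j (proj₁ e)) top × Allowed 0 L↑ top (place j (proj₂ e))
  candidate-sound {a , b} ab∈ with a≢0 , _ , s≤s a≤v , _ , av , vb ← ∈-candidates⁻ {j % 5} {suc v} {L} ab∈ =
    (m≤n⇒m≤1+n (place-≤ j a≤v) , <⇒≢ (s≤s (place-≤ j a≤v))) ,
    (a≢0 ∘ place-injective j {q = 0}) , allowed-place⁺ j av , allowed-place⁺ j vb
  candidate-complete : ∀ {x y} → x ≤ top × x ≢ top → y ≤ top × y ≢ top → x ≢ 0 → x ≢ y →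
             Allowed 0 L↑ x top → Allowed 0 L↑ top y →
             ∃[ e ] e ∈ candidates (j % 5) (suc v) L × place j (proj₁ e) ≡ x × place j (proj₂ e) ≡ y
  candidate-complete (x≤ , x≢) (y≤ , y≢) x≢0 x≢y xt ty
    with x≤′ ← ≤-pred (≤∧≢⇒< x≤ x≢) | y≤′ ← ≤-pred (≤∧≢⇒< y≤ y≢)
    with p , refl ← in-window j {L = L} local x≤′ (inj₁ xt) | q , refl ← in-window j {L = L} local y≤′ (inj₂ ty)
    = (p , q) , ∈-candidates⁺ {j % 5} {suc v} {L} (λ { refl → x≢0 refl }) (x≢y ∘ cong (place j))
        (s≤s (place-≤⁻ j x≤′)) (s≤s (place-≤⁻ j y≤′)) (allowed-place⁻ j xt) (allowed-place⁻ j ty) , refl , refl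
  forced : ∀ {e} → e ∈ candidates (j % 5) (suc v) L →
         Counts (HamiltonianPath (λ x → x ≤ top × x ≢ top)
                   (Force (Allowed 0 L↑) (place j (proj₁ e)) (place j (proj₂ e))) 1 0)
                (f (link e (avoiding (suc v) L)))
  forced {a , b} ab∈ with _ , _ , _ , _ , av , vb ← ∈-candidates⁻ {j % 5} {suc v} {L} ab∈ =
    counts-cong (mk⇔
      (hamiltonianPath-cong (mk⇔ (λ x≤ → m≤n⇒m≤1+n x≤ , <⇒≢ (s≤s x≤)) (λ (x≤ , x≢) → ≤-pred (≤∧≢⇒< x≤ x≢)))
        (λ x≤ y≤ xy → allowed⇒force pi av↑ vb↑ (<⇒≢ (s≤s x≤)) (<⇒≢ (s≤s y≤))
          (allowed-cong {r = 0} (mk⇔ (from links⇔) (to links⇔)) xy)))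
      (hamiltonianPath-cong (mk⇔ (λ (x≤ , x≢) → ≤-pred (≤∧≢⇒< x≤ x≢)) (λ x≤ → m≤n⇒m≤1+n x≤ , <⇒≢ (s≤s x≤)))
        (λ (_ , x≢) (_ , y≢) xy → allowed-cong {r = 0} links⇔ (force⇒allowed pi av↑ vb↑ x≢ y≢ xy))))
    (c (partialInjection-cong links⇔ (partialInjection-force pi av↑ vb↑)))
    where
    links⇔ : ∀ {e} → e ∈ (place j a , place j b) ∷ avoiding top L↑ ⇔
                     e ∈ map (placeLink j) (link (a , b) (avoiding (suc v) L))
    links⇔ = link-place j {v} {a} {b} {L}
    av↑ : Allowed 0 L↑ (place j a) top
    av↑ = allowed-place⁺ j av
    vb↑ : Allowed 0 L↑ top (place j b)
    vb↑ = allowed-place⁺ j vb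

-- Counting by successive elimination

-- At offset 0 no further vertex can refill the window, which shrinks to the corner 1 and the sink.
-- `baseCount v` concerns the codes up to `suc v`.
baseCount : ℕ → Links → ℕ
baseCount zero    L = if does (allowed? 0 L 1 0) then 1 else 0
baseCount (suc v) L = sum (map (baseCount v) (eliminate 0 (2 + v) L))

-- Translates positions at offset `suc j` to offset `j`. Position 1 is freed for the left neighbour
-- of the vertex that now stands at position 6.
up : ℕ → ℕ
up zero    = zero
up (suc p) = suc (suc p)

step : ℕ → Links → List Links
step r L = eliminate r 6 (map (λ (a , b) → up a , up b) L)

count : ℕ → Links → ℕ
count zero    L = baseCount 4 L
count (suc j) L = sum (map (count j) (step (j % 5) L))

counts-dec : ∀ {A Q : Set} {P : A → Set} (Q? : Dec Q) → (Q → Counts P 1) → (¬ Q → Counts P 0) →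
             Counts P (if does Q? then 1 else 0)
counts-dec (yes q) one none = one q
counts-dec (no ¬q) one none = none ¬q

path-1 : ∀ {L w} → Paths 1 L w → w ≡ 1 ∷ 0 ∷ []
path-1 p = helper (starts p) (ends p) (simple p) (to (covers p))
  where
  only-0 : ∀ {y} → y ≤ 1 → 1 ≢ y → y ≡ 0
  only-0 z≤n       _   = refl
  only-0 (s≤s z≤n) 1≢1 = contradiction refl 1≢1
  helper : ∀ {w} → head w ≡ just 1 → last w ≡ just 0 → Unique w → (∀ {x} → x ∈ w → x ≤ 1) → w ≡ 1 ∷ 0 ∷ []
  helper {_ ∷ []} refl () _ _
  helper {_ ∷ _ ∷ []} refl refl _ _ = refl
  helper {_ ∷ y ∷ z ∷ _} refl _ ((1≢y ∷ 1≢z ∷ _) ∷ (y≢z ∷ _) ∷ _) bound = contradiction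
    (trans (only-0 (bound (there (here refl))) 1≢y) (sym (only-0 (bound (there (there (here refl)))) 1≢z))) y≢z

baseCount-counts : ∀ v {L} → PartialInjection (map (placeLink 0) L) →
                   Counts (Paths (suc v) (map (placeLink 0) L)) (baseCount v L)
baseCount-counts zero {L} pi = counts-dec (allowed? 0 L 1 0)
  (λ ok → counts-singleton {a = 1 ∷ 0 ∷ []}
    (record
      { starts = refl
      ; ends   = refl
      ; simple = ((λ ()) ∷ []) ∷ [] ∷ []
      ; arcs   = λ { here → allowed-place⁺ 0 ok ; (there (there ())) }
      ; covers = mk⇔ (λ { (here refl) → s≤s z≤n ; (there (here refl)) → z≤n })
                     (λ { z≤n → there (here refl) ; (s≤s z≤n) → here refl })
      })
    path-1)
  (λ ¬ok → counts-∅ λ {w} p → ¬ok (allowed-place⁻ 0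
    (arcs p (subst (Consecutive 1 0) (sym (path-1 p)) here))))
baseCount-counts (suc v) pi = eliminate-counts 0 (s≤s z≤n) (λ {x} _ _ → local x) pi (baseCount-counts v)
  where
  local : ∀ x → ∃[ p ] x ≡ place 0 p
  local zero    = zero , refl
  local (suc x) = suc x , refl

place-up : ∀ j p → place j (up p) ≡ place (suc j) p
place-up j zero    = refl
place-up j (suc p) = cong suc (+-suc j p)

shift-place : ∀ j L → map (placeLink j) (map (λ (a , b) → up a , up b) L) ≡ map (placeLink (suc j)) L
shift-place j L = trans (sym (List.map-∘ L)) (List.map-cong (λ (a , b) → cong₂ _,_ (place-up j a) (place-up j b)) L)

count-counts : ∀ j {L} → PartialInjection (map (placeLink j) L) →
               Counts (Paths (j + 5) (map (placeLink j) L)) (count j L)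
count-counts zero    pi = baseCount-counts 4 pi
count-counts (suc j) {L} pi =
  subst (λ L↑ → Counts (Paths (suc (j + 5)) L↑) (count (suc j) L)) (shift-place j L)
    (eliminate-counts j (s≤s z≤n) local
      (subst PartialInjection (sym (shift-place j L)) pi) (count-counts j))
  where
  local : Local j 5
  -- Position 6 has only two neighbours with smaller codes: the left one at position 1 and the upper
  -- one at position 5.
  local {x} (inj₁ eq) _ = 1 , sym (+-cancelˡ-≡ 5 _ _
    (trans (cong (λ i → 5 + suc i) (+-identityʳ j)) (trans (cong suc (+-comm 5 j)) eq)))
  local {x} (inj₂ (eq , _)) _ = 5 , trans (sym (suc-injective eq)) (+-suc j 4)

-- Tours as Hamiltonian paths

squares≡1 : ∀ a b → a ^ 2 + b ^ 2 ≡ 1 → (a ≡ 0 × b ≡ 1) ⊎ (a ≡ 1 × b ≡ 0)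
squares≡1 zero          (suc zero) _ = inj₁ (refl , refl)
squares≡1 (suc zero)    zero       _ = inj₂ (refl , refl)
squares≡1 (suc (suc a)) b          ()
squares≡1 zero          (suc (suc b)) ()
squares≡1 (suc zero)    (suc b)    ()

distance≡1 : ∀ m n → ∣ m - n ∣ ≡ 1 → n ≡ suc m ⊎ m ≡ suc n
distance≡1 zero    n       eq = inj₁ eq
distance≡1 (suc m) zero    eq = inj₂ eq
distance≡1 (suc m) (suc n) eq = Sum.map (cong suc) (cong suc) (distance≡1 m n eq)

distance-suc : ∀ m → ∣ m - suc m ∣ ≡ 1
distance-suc zero    = refl
distance-suc (suc m) = distance-suc m

remainder-5 : ∀ c {i} → i < 5 → (c * 5 + i) % 5 ≡ i
remainder-5 c {i} i<5 = trans (cong (_% 5) (+-comm (c * 5) i)) (trans ([m+kn]%n≡m%n i c 5) (m<n⇒m%n≡m i<5))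

division-unique : ∀ c c′ {i i′} → i < 5 → i′ < 5 → c * 5 + i ≡ c′ * 5 + i′ → c ≡ c′ × i ≡ i′
division-unique c c′ {i} {i′} i<5 i′<5 eq = *-cancelʳ-≡ c c′ 5 (+-cancelʳ-≡ i (c * 5) (c′ * 5)
  (trans eq (cong (λ x → c′ * 5 + x) (sym i≡i′)))) , i≡i′
  where
  i≡i′ : i ≡ i′
  i≡i′ = trans (sym (remainder-5 c i<5)) (trans (cong (_% 5) eq) (remainder-5 c′ i′<5))

module _ {n : ℕ} where

  code : Vertex 5 n → ℕ
  code (i , c) = suc (toℕ c * 5 + toℕ i)

  Right Below : Vertex 5 n → Vertex 5 n → Set
  Right (i , c) (i′ , c′) = toℕ c′ ≡ suc (toℕ c) × toℕ i′ ≡ toℕ i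
  Below (i , c) (i′ , c′) = toℕ c′ ≡ toℕ c × toℕ i′ ≡ suc (toℕ i)

  adjacent⇔ : ∀ u v → Adjacent u v ⇔ ((Right u v ⊎ Below u v) ⊎ (Right v u ⊎ Below v u))
  adjacent⇔ (i , c) (i′ , c′) = mk⇔ into out-of
    where
    Moves : Set
    Moves = (Right (i , c) (i′ , c′) ⊎ Below (i , c) (i′ , c′)) ⊎ (Right (i′ , c′) (i , c) ⊎ Below (i′ , c′) (i , c))
    into : Adjacent (i , c) (i′ , c′) → Moves
    into adj with squares≡1 ∣ toℕ i - toℕ i′ ∣ ∣ toℕ c - toℕ c′ ∣ adj
    ... | inj₁ (i≡i′ , d) with distance≡1 (toℕ c) (toℕ c′) d | ∣m-n∣≡0⇒m≡n {toℕ i} {toℕ i′} i≡i′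
    ...   | inj₁ eq | eq′ = inj₁ (inj₁ (eq , sym eq′))
    ...   | inj₂ eq | eq′ = inj₂ (inj₁ (eq , eq′))
    into adj | inj₂ (d , c≡c′) with distance≡1 (toℕ i) (toℕ i′) d | ∣m-n∣≡0⇒m≡n {toℕ c} {toℕ c′} c≡c′
    ...   | inj₁ eq | eq′ = inj₁ (inj₂ (sym eq′ , eq))
    ...   | inj₂ eq | eq′ = inj₂ (inj₂ (eq′ , eq))
    sum≡1 : ∀ {a b} → (a ≡ 0 × b ≡ 1) ⊎ (a ≡ 1 × b ≡ 0) → a ^ 2 + b ^ 2 ≡ 1
    sum≡1 (inj₁ (refl , refl)) = refl
    sum≡1 (inj₂ (refl , refl)) = refl
    stay : ∀ {a b} → b ≡ a → ∣ a - b ∣ ≡ 0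
    stay {a} refl = ∣n-n∣≡0 a
    forward : ∀ {a b} → b ≡ suc a → ∣ a - b ∣ ≡ 1
    forward {a} refl = distance-suc a
    backward : ∀ {a b} → a ≡ suc b → ∣ a - b ∣ ≡ 1
    backward {a} {b} eq = trans (∣-∣-comm a b) (forward eq)
    out-of : Moves → Adjacent (i , c) (i′ , c′)
    out-of (inj₁ (inj₁ (p , q))) = sum≡1 (inj₁ (stay q , forward p))
    out-of (inj₁ (inj₂ (p , q))) = sum≡1 (inj₂ (forward q , stay p))
    out-of (inj₂ (inj₁ (p , q))) = sum≡1 (inj₁ (stay (sym q) , backward p))
    out-of (inj₂ (inj₂ (p , q))) = sum≡1 (inj₂ (backward q , stay (sym p)))

  next-code : ∀ u v → (Right u v ⊎ Below u v) ⇔ Next 0 (code u) (code v)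
  next-code (i , c) (i′ , c′) = mk⇔ into out-of
    where
    below : ∀ {k} → suc k < 5 → suc (toℕ c * 5 + k) % 5 ≢ 0
    below {k} k<4 eq with () ← trans (sym (remainder-5 (toℕ c) k<4)) (trans (cong (_% 5) (+-suc (toℕ c * 5) k)) eq)
    into : Right (i , c) (i′ , c′) ⊎ Below (i , c) (i′ , c′) → Next 0 (code (i , c)) (code (i′ , c′))
    into (inj₁ (p , q)) = inj₁ (cong suc (cong₂ (λ c i → c * 5 + i) p q))
    into (inj₂ (p , q)) = inj₂
      ( cong suc (trans (cong₂ (λ c i → c * 5 + i) p q) (+-suc (toℕ c * 5) (toℕ i)))
      , below (subst (_< 5) q (toℕ<n i′)))
    out-of : Next 0 (code (i , c)) (code (i′ , c′)) → Right (i , c) (i′ , c′) ⊎ Below (i , c) (i′ , c′)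
    out-of (inj₁ eq) = inj₁ (division-unique (toℕ c′) (suc (toℕ c)) (toℕ<n i′) (toℕ<n i) (suc-injective eq))
    out-of (inj₂ (eq , r≢0)) = inj₂ (division-unique (toℕ c′) (toℕ c) (toℕ<n i′) (≤∧≢⇒< (toℕ<n i) i≢4)
                                    (trans (suc-injective eq) (sym (+-suc (toℕ c * 5) (toℕ i)))))
      where
      -- The bottom vertex of a column has a code divisible by 5, which `Next` bars from a downward
      -- move.
      i≢4 : suc (toℕ i) ≢ 5
      i≢4 eq = r≢0 (trans (cong (_% 5) (trans (sym (+-suc (toℕ c * 5) (toℕ i)))
                             (trans (cong (λ x → toℕ c * 5 + x) eq) (+-comm (toℕ c * 5) 5))))
                          ([m+kn]%n≡m%n 5 (toℕ c) 5))

  arc-code : ∀ u v → Adjacent u v ⇔ Arc 0 (code u) (code v)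
  arc-code u v = mk⇔
    (Sum.map (to (next-code u v)) (to (next-code v u)) ∘ to (adjacent⇔ u v))
    (from (adjacent⇔ u v) ∘ Sum.map (from (next-code u v)) (from (next-code v u)))

  code-injective : ∀ {u v} → code u ≡ code v → u ≡ v
  code-injective {i , c} {i′ , c′} eq
    with c≡c′ , i≡i′ ← division-unique (toℕ c) (toℕ c′) (toℕ<n i) (toℕ<n i′) (suc-injective eq)
    = cong₂ _,_ (toℕ-injective i≡i′) (toℕ-injective c≡c′)

  code-≤ : ∀ v → code v ≤ n * 5
  code-≤ (i , c) = ≤-trans (≤-reflexive (sym (+-suc (toℕ c * 5) (toℕ i))))
    (≤-trans (+-monoʳ-≤ (toℕ c * 5) (toℕ<n i)) (≤-trans (≤-reflexive (+-comm (toℕ c * 5) 5)) (*-monoˡ-≤ 5 (toℕ<n c))))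

  code-surjective : ∀ {x} → x ≢ 0 → x ≤ n * 5 → ∃[ v ] x ≡ code v
  code-surjective {zero}  x≢0 _  = contradiction refl x≢0
  code-surjective {suc x} _   x< = (fromℕ< (m%n<n x 5) , fromℕ< x/5<n) , cong suc (begin
    x                                                  ≡⟨ m≡m%n+[m/n]*n x 5 ⟩
    x % 5 + x / 5 * 5                                  ≡⟨ +-comm (x % 5) (x / 5 * 5) ⟩
    x / 5 * 5 + x % 5                                  ≡⟨ cong₂ (λ c i → c * 5 + i) (toℕ-fromℕ< x/5<n)
                                                              (toℕ-fromℕ< (m%n<n x 5)) ⟨
    toℕ (fromℕ< x/5<n) * 5 + toℕ (fromℕ< (m%n<n x 5)) ∎)
    where
    open ≡-Reasoning
    x/5<n : x / 5 < n
    x/5<n = *-cancelʳ-< 5 (x / 5) n (≤-<-trans (≤-trans (m≤n+m _ (x % 5)) (≤-reflexive (sym (m≡m%n+[m/n]*n x 5)))) x<)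

module _ {A : Set} where

  linked⇒consecutive : ∀ {R : A → A → Set} {w} → Linked R w → ∀ {x y} → Consecutive x y w → R x y
  linked⇒consecutive (r ∷ _)  here      = r
  linked⇒consecutive (_ ∷ rs) (there c) = linked⇒consecutive rs c
  linked⇒consecutive [-] (there ())

  consecutive⇒linked : ∀ {R : A → A → Set} w → (∀ {x y} → Consecutive x y w → R x y) → Linked R w
  consecutive⇒linked []          _ = []
  consecutive⇒linked (_ ∷ [])    _ = [-]
  consecutive⇒linked (x ∷ y ∷ w) r = r here ∷ consecutive⇒linked (y ∷ w) (r ∘ there)

  last-∷ʳ : ∀ xs {x : A} → last (xs ∷ʳ x) ≡ just x
  last-∷ʳ []           = refl
  last-∷ʳ (_ ∷ [])     = refl
  last-∷ʳ (_ ∷ y ∷ xs) = last-∷ʳ (y ∷ xs)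

  consecutive-∷ʳ⁻ : ∀ {w x y z} → Consecutive {A} x y (w ∷ʳ z) → Consecutive x y w ⊎ (x ∈ w × y ≡ z)
  consecutive-∷ʳ⁻ {[]} (there ())
  consecutive-∷ʳ⁻ {_ ∷ []} here = inj₂ (here refl , refl)
  consecutive-∷ʳ⁻ {_ ∷ []} (there (there ()))
  consecutive-∷ʳ⁻ {_ ∷ _ ∷ _} here = inj₁ here
  consecutive-∷ʳ⁻ {_ ∷ _ ∷ _} (there c) with consecutive-∷ʳ⁻ c
  ... | inj₁ c′        = inj₁ (there c′)
  ... | inj₂ (x∈ , eq) = inj₂ (there x∈ , eq)

  consecutive-∷ʳ⁺ : ∀ {w x y z} → Consecutive {A} x y w → Consecutive x y (w ∷ʳ z)
  consecutive-∷ʳ⁺ here      = here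
  consecutive-∷ʳ⁺ (there c) = there (consecutive-∷ʳ⁺ c)

module _ {A B : Set} {f : A → B} where

  consecutive-map⁺ : ∀ {w x y} → Consecutive x y w → Consecutive (f x) (f y) (map f w)
  consecutive-map⁺ here      = here
  consecutive-map⁺ (there c) = there (consecutive-map⁺ c)

  consecutive-map⁻ : ∀ {w x y} → Consecutive x y (map f w) →
                     ∃[ u ] ∃[ v ] Consecutive u v w × x ≡ f u × y ≡ f v
  consecutive-map⁻ {_ ∷ []} (there ())
  consecutive-map⁻ {_ ∷ _ ∷ _} here = _ , _ , here , refl , refl
  consecutive-map⁻ {_ ∷ _ ∷ _} (there c) =
    let u , v , c′ , eqs = consecutive-map⁻ c in u , v , there c′ , eqs

  map-surjective : ∀ ys → (∀ {y} → y ∈ ys → ∃[ x ] y ≡ f x) → ∃[ xs ] ys ≡ map f xs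
  map-surjective []       _ = [] , refl
  map-surjective (y ∷ ys) s =
    let x , eq = s (here refl) ; xs , eqs = map-surjective ys (s ∘ there) in x ∷ xs , cong₂ _∷_ eq eqs

module _ {n : ℕ} where

  private
    path : List (Vertex 5 n) → List ℕ
    path w = map code w ∷ʳ 0

  path-injective : ∀ {w w′} → path w ≡ path w′ → w ≡ w′
  path-injective eq = List.map-injective code-injective (List.∷ʳ-injectiveˡ _ _ eq)

  tour⇒path : ∀ {w} → IsGreekKeyTour 5 n w → Paths (n * 5) [] (path w)
  tour⇒path {w} (upperLeft , linked , w! , all) = record
    { starts = starts′ w upperLeft
    ; ends   = last-∷ʳ (map code w)
    ; simple = Unique.++⁺ (Unique.map⁺ code-injective w!) ([] ∷ []) (λ { (0∈ , here refl) → 0∉ 0∈ })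
    ; arcs   = λ c → inj₂ (arc c , (λ ()) , (λ ()))
    ; covers = mk⇔ bound cover
    }
    where
    0∉ : 0 ∉ map code w
    0∉ 0∈ with _ , _ , () ← ∈-map⁻ code 0∈
    starts′ : ∀ w → Maybe.Any UpperLeft (head w) → head (path w) ≡ just 1
    starts′ (_ ∷ _) (Maybe.just (p , q)) = cong just (cong suc (cong₂ (λ c i → c * 5 + i) q p))
    arc : ∀ {x y} → Consecutive x y (path w) → Arc 0 x y
    arc c with consecutive-∷ʳ⁻ c
    ... | inj₁ c′ with u , v , c″ , refl , refl ← consecutive-map⁻ c′ =
      to (arc-code u v) (linked⇒consecutive linked c″)
    ... | inj₂ (x∈ , refl) with _ , _ , refl ← ∈-map⁻ code x∈ = tt
    bound : ∀ {x} → x ∈ path w → x ≤ n * 5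
    bound x∈ with ∈-++⁻ (map code w) x∈
    ... | inj₁ x∈′ with v , _ , refl ← ∈-map⁻ code x∈′ = code-≤ v
    ... | inj₂ (here refl) = z≤n
    cover : ∀ {x} → x ≤ n * 5 → x ∈ path w
    cover {zero}  _  = ∈-++⁺ʳ (map code w) (here refl)
    cover {suc x} x≤ with v , eq ← code-surjective {n} {suc x} (λ ()) x≤ =
      ∈-++⁺ˡ (subst (_∈ map code w) (sym eq) (∈-map⁺ code (all v)))

  unique-∷ʳ : ∀ {u : List ℕ} {x} → Unique (u ∷ʳ x) → Unique (x ∷ u)
  unique-∷ʳ {u} {x} = Unique-resp-↭ (↭-sym (∷↭∷ʳ x u))

  path-surjective : ∀ {w⁺} → Paths (n * 5) [] w⁺ → ∃[ w ] w⁺ ≡ path w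
  path-surjective {w⁺} p with initLast w⁺
  ... | [] with () ← starts p
  ... | u ∷ʳ′ z with refl ← just-injective (trans (sym (last-∷ʳ u)) (ends p))
    = let w , eq = map-surjective u (λ x∈ → code-surjective
                     (λ { refl → head∉tail (unique-∷ʳ (simple p)) x∈ }) (to (covers p) (∈-++⁺ˡ x∈)))
      in w , cong (_∷ʳ 0) eq

  path⇒tour : ∀ {w⁺} → Paths (n * 5) [] w⁺ → ∃[ w ] IsGreekKeyTour 5 n w × w⁺ ≡ path w
  path⇒tour p with w , refl ← path-surjective p
    = w , (upperLeft w (starts p) , consecutive⇒linked w adjacent
          , Unique.map⁻ (Unique-tail (unique-∷ʳ (simple p))) , all) , refl
    where
    upperLeft : ∀ w → head (path w) ≡ just 1 → Maybe.Any UpperLeft (head w)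
    upperLeft [] ()
    upperLeft ((i , c) ∷ _) eq
      with c≡0 , i≡0 ← division-unique (toℕ c) 0 (toℕ<n i) (s≤s z≤n) (suc-injective (just-injective eq))
      = Maybe.just (i≡0 , c≡0)
    adjacent : ∀ {u v} → Consecutive u v w → Adjacent u v
    adjacent {u} {v} c with arcs p (consecutive-∷ʳ⁺ (consecutive-map⁺ c))
    ... | inj₂ (arc , _) = from (arc-code u v) arc
    all : ∀ v → v ∈ w
    all v with ∈-++⁻ (map code w) (from (covers p) (code-≤ v))
    ... | inj₁ v∈ with _ , v∈′ , eq ← ∈-map⁻ code v∈ = subst (_∈ w) (sym (code-injective eq)) v∈′
    ... | inj₂ (here ())

-- The window at offset `m * 5` is exactly the last of `suc m` columns, and initially no arc is
-- forced.
g≡count : ∀ m → g 5 (suc m) ≡ count (m * 5) []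
g≡count m = counts-functional
  (counts-cong (mk⇔ (λ { (w , t , refl) → tour⇒path t }) path⇒tour)
    (counts-image (λ w → map code w ∷ʳ 0) (λ _ _ → path-injective) tours))
  (subst (λ k → Counts (Paths k []) (count (m * 5) [])) (+-comm (m * 5) 5)
    (count-counts (m * 5) ((λ ()) , (λ ()))))
  where
  tours : Counts (IsGreekKeyTour 5 (suc m)) (g 5 (suc m))
  tours = record
    { elements = greekKeyTours 5 (suc m)
    ; unique   = greekKeyTours-unique 5 (suc m)
    ; sound    = to ∈-greekKeyTours
    ; complete = from ∈-greekKeyTours
    ; size     = refl
    }

-- Formal linear combinations of states

-- A search tree by state, in which equal states reached along different routes merge. Coefficients
-- that cancel remain as explicit zeros.
data Tree : Set where
  leaf : Tree
  node : Tree → Links → ℤ → Tree → Tree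

_≟ᴸ_ : DecidableEquality Links
_≟ᴸ_ = List.≡-dec (≡-dec _≟_ _≟_)

-- The key only steers the search; no property of it is needed.
key : Links → ℕ
key = foldr (λ (a , b) k → b + 7 * (a + 7 * k)) 0

add : ℤ → Links → Tree → Tree
add c L leaf = node leaf L c leaf
add c L (node l L′ c′ r) =
  if key L <ᵇ key L′ then node (add c L l) L′ c′ r else
  if does (L ≟ᴸ L′) then node l L′ (c ℤ.+ c′) r else node l L′ c′ (add c L r)

addAll : ℤ → List Links → Tree → Tree
addAll c Ls t = foldr (add c) t Ls

-- The linear extension of `f` to formal combinations, accumulated onto `acc`.
expand : (Links → List Links) → Tree → Tree → Tree
expand f leaf           acc = acc
expand f (node l L c r) acc = expand f l (addAll c (f L) (expand f r acc))

sweep : (Links → List Links) → Tree → Tree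
sweep f t = expand f t leaf

plus : ℤ → Tree → Tree → Tree
plus k leaf           acc = acc
plus k (node l L c r) acc = plus k l (add (k ℤ.* c) L (plus k r acc))

eval : (Links → ℕ) → Tree → ℤ
eval f leaf           = 0ℤ
eval f (node l L c r) = eval f l ℤ.+ (c ℤ.* + f L ℤ.+ eval f r)

isZero : Tree → Bool
isZero leaf           = true
isZero (node l L c r) = isZero l ∧ (does (c ℤ.≟ 0ℤ) ∧ isZero r)

eval-cong : ∀ {f f′} → (∀ L → f L ≡ f′ L) → ∀ t → eval f t ≡ eval f′ t
eval-cong eq leaf           = refl
eval-cong eq (node l L c r) = cong₂ ℤ._+_ (eval-cong eq l) (cong₂ ℤ._+_ (cong (λ x → c ℤ.* + x) (eq L)) (eval-cong eq r))

eval-add : ∀ f c L t → eval f (add c L t) ≡ c ℤ.* + f L ℤ.+ eval f t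
eval-add f c L leaf = ℤ.+-identityˡ _
eval-add f c L (node l L′ c′ r) with key L <ᵇ key L′
... | true rewrite eval-add f c L l = ℤ.+-assoc (c ℤ.* + f L) (eval f l) (c′ ℤ.* + f L′ ℤ.+ eval f r)
... | false with L ≟ᴸ L′
...   | yes refl = lemma c c′ (+ f L) (eval f l) (eval f r)
  where
  lemma : ∀ c c′ x y z → y ℤ.+ ((c ℤ.+ c′) ℤ.* x ℤ.+ z) ≡ c ℤ.* x ℤ.+ (y ℤ.+ (c′ ℤ.* x ℤ.+ z))
  lemma = solve-∀
...   | no _ rewrite eval-add f c L r = lemma (eval f l) (c′ ℤ.* + f L′) (c ℤ.* + f L) (eval f r)
  where
  lemma : ∀ y w x z → y ℤ.+ (w ℤ.+ (x ℤ.+ z)) ≡ x ℤ.+ (y ℤ.+ (w ℤ.+ z))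
  lemma = solve-∀

eval-addAll : ∀ f c Ls t → eval f (addAll c Ls t) ≡ c ℤ.* + sum (map f Ls) ℤ.+ eval f t
eval-addAll f c []       t = sym (trans (cong (ℤ._+ eval f t) (ℤ.*-zeroʳ c)) (ℤ.+-identityˡ _))
eval-addAll f c (L ∷ Ls) t = trans (eval-add f c L (addAll c Ls t)) (trans
  (cong (λ x → c ℤ.* + f L ℤ.+ x) (eval-addAll f c Ls t))
  (lemma c (+ f L) (+ sum (map f Ls)) (eval f t)))
  where
  lemma : ∀ c x y z → c ℤ.* x ℤ.+ (c ℤ.* y ℤ.+ z) ≡ c ℤ.* (x ℤ.+ y) ℤ.+ z
  lemma = solve-∀

eval-expand : ∀ f σ t acc → eval f (expand σ t acc) ≡ eval (λ L → sum (map f (σ L))) t ℤ.+ eval f acc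
eval-expand f σ leaf           acc = sym (ℤ.+-identityˡ _)
eval-expand f σ (node l L c r) acc
  rewrite eval-expand f σ l (addAll c (σ L) (expand σ r acc))
        | eval-addAll f c (σ L) (expand σ r acc)
        | eval-expand f σ r acc
  = lemma (eval (λ L → sum (map f (σ L))) l) (c ℤ.* + sum (map f (σ L))) (eval (λ L → sum (map f (σ L))) r) (eval f acc)
  where
  lemma : ∀ x y z w → x ℤ.+ (y ℤ.+ (z ℤ.+ w)) ≡ (x ℤ.+ (y ℤ.+ z)) ℤ.+ w
  lemma = solve-∀

eval-sweep : ∀ f σ t → eval f (sweep σ t) ≡ eval (λ L → sum (map f (σ L))) t
eval-sweep f σ t = trans (eval-expand f σ t leaf) (ℤ.+-identityʳ _)

eval-plus : ∀ f k t acc → eval f (plus k t acc) ≡ k ℤ.* eval f t ℤ.+ eval f acc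
eval-plus f k leaf           acc = sym (trans (cong (ℤ._+ eval f acc) (ℤ.*-zeroʳ k)) (ℤ.+-identityˡ _))
eval-plus f k (node l L c r) acc
  rewrite eval-plus f k l (add (k ℤ.* c) L (plus k r acc))
        | eval-add f (k ℤ.* c) L (plus k r acc)
        | eval-plus f k r acc
  = lemma k c (eval f l) (+ f L) (eval f r) (eval f acc)
  where
  lemma : ∀ k c x y z w → k ℤ.* x ℤ.+ ((k ℤ.* c) ℤ.* y ℤ.+ (k ℤ.* z ℤ.+ w)) ≡ k ℤ.* (x ℤ.+ (c ℤ.* y ℤ.+ z)) ℤ.+ w
  lemma = solve-∀

eval-isZero : ∀ f t → isZero t ≡ true → eval f t ≡ 0ℤ
eval-isZero f leaf           _  = refl
eval-isZero f (node l L c r) eq with isZero l in eqˡ | c ℤ.≟ 0ℤ | isZero r in eqʳ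
... | true | yes refl | true rewrite eval-isZero f l eqˡ | eval-isZero f r eqʳ = refl

-- Columns

-- The bottom row goes first, hence `step 4` is innermost: the offset falls from `suc m * 5` to
-- `m * 5` through the residues 4, 3, 2, 1, 0.
column : Tree → Tree
column t = sweep (step 0) (sweep (step 1) (sweep (step 2) (sweep (step 3) (sweep (step 4) t))))

firstColumn : Tree → Tree
firstColumn t = sweep (eliminate 0 2) (sweep (eliminate 0 3) (sweep (eliminate 0 4) (sweep (eliminate 0 5) t)))

-- The index is one less than the number of columns, since the window itself is a column.
value : ℕ → Tree → ℤ
value m = eval (count (m * 5))

-- The steps see the offset only modulo 5, so a single operator independent of `m` realises the
-- shift of the sequence of values. Polynomials in `column` thereby become recurrences.
value-column : ∀ m t → value m (column t) ≡ value (suc m) t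
value-column m t =
  trans (row 0 (sweep (step 1) (sweep (step 2) (sweep (step 3) (sweep (step 4) t)))))
  (trans (row 1 (sweep (step 2) (sweep (step 3) (sweep (step 4) t))))
  (trans (row 2 (sweep (step 3) (sweep (step 4) t)))
  (trans (row 3 (sweep (step 4) t)) (row 4 t))))
  where
  row : ∀ i t → eval (count (i + m * 5)) (sweep (step (i % 5)) t) ≡ eval (count (suc i + m * 5)) t
  row i t = trans (eval-sweep (count (i + m * 5)) (step (i % 5)) t)
    (eval-cong (λ L → cong (λ r → sum (map (count (i + m * 5)) (step r L))) (sym ([m+kn]%n≡m%n i m 5))) t)

value-firstColumn : ∀ t → eval (baseCount 0) (firstColumn t) ≡ value 0 t
value-firstColumn t =
  trans (eval-sweep (baseCount 0) (eliminate 0 2) (sweep (eliminate 0 3) (sweep (eliminate 0 4) (sweep (eliminate 0 5) t))))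
  (trans (eval-sweep (baseCount 1) (eliminate 0 3) (sweep (eliminate 0 4) (sweep (eliminate 0 5) t)))
  (trans (eval-sweep (baseCount 2) (eliminate 0 4) (sweep (eliminate 0 5) t))
         (eval-sweep (baseCount 3) (eliminate 0 5) t)))

-- The computable form of `value`: a combination is pushed through whole columns with equal states
-- merged at every step, whereas `count` branches on each state anew.
values : ℕ → Tree → List ℤ
values zero    t = []
values (suc n) t = eval (baseCount 0) (firstColumn t) ∷ values n (column t)

values-correct : ∀ n t {h : ℕ → ℤ} → (∀ m → value m t ≡ h m) → values n t ≡ applyUpTo h n
values-correct zero    t eq = refl
values-correct (suc n) t eq = cong₂ _∷_ (trans (value-firstColumn t) (eq 0))
  (values-correct n (column t) (λ m → trans (value-column m t) (eq (suc m))))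

-- Linear recurrences

combination : List ℤ → (ℕ → ℤ) → ℕ → ℤ
combination []       h m = 0ℤ
combination (c ∷ cs) h m = c ℤ.* h m ℤ.+ combination cs h (suc m)

-- Horner evaluation at `column` of the polynomial with coefficients `cs`, lowest degree first.
apply : List ℤ → Tree → Tree
apply []       t = leaf
apply (c ∷ cs) t = plus c t (column (apply cs t))

value-apply : ∀ cs t m → value m (apply cs t) ≡ combination cs (λ k → value k t) m
value-apply []       t m = refl
value-apply (c ∷ cs) t m = trans (eval-plus (count (m * 5)) c t (column (apply cs t)))
  (cong (λ x → c ℤ.* value m t ℤ.+ x) (trans (value-column m (apply cs t)) (value-apply cs t (suc m))))

combination-last : ∀ cs h m → (∀ k → k < length cs → h (m + k) ≡ 0ℤ) →
                   combination (cs ∷ʳ 1ℤ) h m ≡ h (m + length cs)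
combination-last []       h m _ = trans (ℤ.+-identityʳ _) (trans (ℤ.*-identityˡ (h m)) (cong h (sym (ℕ.+-identityʳ m))))
combination-last (c ∷ cs) h m zeros = begin
  c ℤ.* h m ℤ.+ combination (cs ∷ʳ 1ℤ) h (suc m) ≡⟨ cong (λ x → c ℤ.* x ℤ.+ combination (cs ∷ʳ 1ℤ) h (suc m))
                                                      (trans (cong h (sym (ℕ.+-identityʳ m))) (zeros 0 (s≤s z≤n))) ⟩
  c ℤ.* 0ℤ ℤ.+ combination (cs ∷ʳ 1ℤ) h (suc m)  ≡⟨ cong (ℤ._+ combination (cs ∷ʳ 1ℤ) h (suc m)) (ℤ.*-zeroʳ c) ⟩
  0ℤ ℤ.+ combination (cs ∷ʳ 1ℤ) h (suc m)        ≡⟨ ℤ.+-identityˡ _ ⟩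
  combination (cs ∷ʳ 1ℤ) h (suc m)               ≡⟨ combination-last cs h (suc m)
                                                      (λ k k< → trans (cong h (sym (ℕ.+-suc m k))) (zeros (suc k) (s≤s k<))) ⟩
  h (suc m + length cs)                          ≡⟨ cong h (ℕ.+-suc m (length cs)) ⟨
  h (m + suc (length cs))                        ∎
  where open ≡-Reasoning

-- A run of `length cs` zeros moves forward: since the leading coefficient is 1, the recurrence
-- makes the entry after the run zero. The bound `k ≤ length cs` takes in that entry.
recurrence-zero : ∀ cs {h : ℕ → ℤ} → (∀ m → combination (cs ∷ʳ 1ℤ) h m ≡ 0ℤ) →
                  (∀ k → k < length cs → h k ≡ 0ℤ) → ∀ m k → k ≤ length cs → h (m + k) ≡ 0ℤ
recurrence-zero cs {h} rec initial = λ m k k≤ → case m k k≤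
  where
  window : ∀ m k → k < length cs → h (m + k) ≡ 0ℤ
  case : ∀ m k → k ≤ length cs → h (m + k) ≡ 0ℤ
  window zero    k k< = initial k k<
  window (suc m) k k< = trans (cong h (sym (ℕ.+-suc m k))) (case m (suc k) k<)
  case m k k≤ with ℕ.m≤n⇒m<n∨m≡n k≤
  ... | inj₁ k<   = window m k k<
  ... | inj₂ refl = trans (sym (combination-last cs h m (window m))) (rec m)

-- Power series

sumUpTo : (ℕ → ℤ) → ℕ → ℤ
sumUpTo f n = foldr ℤ._+_ 0ℤ (applyUpTo f n)

sumUpTo-cong : ∀ {f f′} n → (∀ i → i < n → f i ≡ f′ i) → sumUpTo f n ≡ sumUpTo f′ n
sumUpTo-cong zero    eq = refl
sumUpTo-cong (suc n) eq = cong₂ ℤ._+_ (eq 0 (s≤s z≤n)) (sumUpTo-cong n (λ i i< → eq (suc i) (s≤s i<)))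

sumUpTo-zero : ∀ {f} n → (∀ i → i < n → f i ≡ 0ℤ) → sumUpTo f n ≡ 0ℤ
sumUpTo-zero zero    eq = refl
sumUpTo-zero (suc n) eq = cong₂ ℤ._+_ (eq 0 (s≤s z≤n)) (sumUpTo-zero n (λ i i< → eq (suc i) (s≤s i<)))

sumUpTo-drop : ∀ {f} m n → (∀ i → i < m → f i ≡ 0ℤ) → sumUpTo f (m + n) ≡ sumUpTo (λ i → f (m + i)) n
sumUpTo-drop zero    n eq = refl
sumUpTo-drop (suc m) n eq = trans (cong₂ ℤ._+_ (eq 0 (s≤s z≤n)) (sumUpTo-drop m n (λ i i< → eq (suc i) (s≤s i<))))
                                  (ℤ.+-identityˡ _)

sumUpTo-combination : ∀ h q m n → sumUpTo (λ i → h (m + i) ℤ.* q i) n ≡ combination (applyUpTo q n) h m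
sumUpTo-combination h q m zero    = refl
sumUpTo-combination h q m (suc n) = cong₂ ℤ._+_
  (trans (ℤ.*-comm (h (m + 0)) (q 0)) (cong (λ k → q 0 ℤ.* h k) (ℕ.+-identityʳ m)))
  (trans (sumUpTo-cong n (λ i _ → cong (λ k → h k ℤ.* q (suc i)) (ℕ.+-suc m i)))
         (sumUpTo-combination h (q ∘ suc) (suc m) n))

combination-cong : ∀ cs {h h′ : ℕ → ℤ} → (∀ m → h m ≡ h′ m) → ∀ m → combination cs h m ≡ combination cs h′ m
combination-cong []       eq m = refl
combination-cong (c ∷ cs) eq m = cong₂ ℤ._+_ (cong (c ℤ.*_) (eq m)) (combination-cong cs eq (suc m))

combination-suc : ∀ cs h m → combination cs h (suc m) ≡ combination cs (h ∘ suc) m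
combination-suc []       h m = refl
combination-suc (c ∷ cs) h m = cong (λ x → c ℤ.* h (suc m) ℤ.+ x) (combination-suc cs h (suc m))

DegreeBelow : ℕ → Series → Set
DegreeBelow n a = ∀ i → n ≤ i → a i ≡ 0ℤ

poly-zeros : ∀ n i → poly (replicate n 0ℤ) i ≡ 0ℤ
poly-zeros zero    i       = refl
poly-zeros (suc n) zero    = refl
poly-zeros (suc n) (suc i) = poly-zeros n i

poly-degree : ∀ cs → DegreeBelow (length cs) (poly cs)
poly-degree []       i       _        = refl
poly-degree (c ∷ cs) (suc i) (s≤s le) = poly-degree cs i le

⊛-degree : ∀ {a b} p q → DegreeBelow (suc p) a → DegreeBelow (suc q) b → DegreeBelow (suc (p + q)) (a ⊛ b)
⊛-degree {a} {b} p q a-below b-below n p+q<n = sumUpTo-zero (suc n) (λ i _ → term i)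
  where
  term : ∀ i → a i ℤ.* b (n ∸ i) ≡ 0ℤ
  term i with suc p ℕ.≤? i
  ... | yes p<i = trans (cong (ℤ._* b (n ∸ i)) (a-below i p<i)) (ℤ.*-zeroˡ (b (n ∸ i)))
  ... | no  p≮i = trans (cong (a i ℤ.*_) (b-below (n ∸ i) q<)) (ℤ.*-zeroʳ (a i))
    where
    i≤p : i ≤ p
    i≤p = ℕ.≤-pred (ℕ.≰⇒> p≮i)
    q< : suc q ≤ n ∸ i
    q< = ℕ.m+n≤o⇒m≤o∸n (suc q) (ℕ.≤-trans (s≤s (ℕ.≤-trans (ℕ.+-monoʳ-≤ q i≤p) (ℕ.≤-reflexive (ℕ.+-comm q p)))) p+q<n)

⊛-prefix : ∀ {a a′} b n → (∀ i → i ≤ n → a i ≡ a′ i) → (a ⊛ b) n ≡ (a′ ⊛ b) n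
⊛-prefix b n eq = sumUpTo-cong (suc n) λ i i< → cong (ℤ._* b (n ∸ i)) (eq i (ℕ.≤-pred i<))

-- Here `poly` serves as list lookup, turning a computed equality of lists into equalities of their
-- entries.
poly-applyUpTo : ∀ f {n} i → i < n → poly (applyUpTo f n) i ≡ f i
poly-applyUpTo f {suc n} zero    _       = refl
poly-applyUpTo f {suc n} (suc i) (s≤s i<) = poly-applyUpTo (f ∘ suc) i i<

-- From degree `d` on, all coefficients of `b` take part and the product is a linear recurrence
-- whose coefficients are those of `b` reversed.
⊛-tail : ∀ a {b} d → DegreeBelow (suc d) b → ∀ m →
         (a ⊛ b) (m + d) ≡ combination (applyUpTo (λ i → b (d ∸ i)) (suc d)) a m
⊛-tail a {b} d b-below m = begin
  sumUpTo (λ i → a i ℤ.* b (m + d ∸ i)) (suc (m + d))      ≡⟨ cong (sumUpTo (λ i → a i ℤ.* b (m + d ∸ i))) (ℕ.+-suc m d) ⟨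
  sumUpTo (λ i → a i ℤ.* b (m + d ∸ i)) (m + suc d)        ≡⟨ sumUpTo-drop m (suc d) vanish ⟩
  sumUpTo (λ i → a (m + i) ℤ.* b (m + d ∸ (m + i))) (suc d) ≡⟨ sumUpTo-cong (suc d) (λ i _ →
                                                                 cong (λ k → a (m + i) ℤ.* b k) (ℕ.[m+n]∸[m+o]≡n∸o m d i)) ⟩
  sumUpTo (λ i → a (m + i) ℤ.* b (d ∸ i)) (suc d)          ≡⟨ sumUpTo-combination a (λ i → b (d ∸ i)) m (suc d) ⟩
  combination (applyUpTo (λ i → b (d ∸ i)) (suc d)) a m    ∎
  where
  open ≡-Reasoning
  vanish : ∀ i → i < m → a i ℤ.* b (m + d ∸ i) ≡ 0ℤ
  vanish i i<m = trans (cong (a i ℤ.*_) (b-below (m + d ∸ i)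
    (ℕ.m+n≤o⇒m≤o∸n (suc d) (ℕ.≤-trans (ℕ.≤-reflexive (cong suc (ℕ.+-comm d i))) (ℕ.+-monoˡ-≤ d i<m)))))
    (ℤ.*-zeroʳ (a i))

-- The certificate

initial : Tree
initial = node leaf [] 1ℤ leaf

-- The coefficients of `Q` from degree 13 down to the constant term 1, that is, the characteristic
-- polynomial of the recurrence.
Qᴿ : List ℤ
Qᴿ = + 2 ∷ + 0 ∷ + 14 ∷ + 0 ∷ - + 9 ∷ + 6 ∷ + 84 ∷ - + 2 ∷ - + 117 ∷ + 33 ∷ + 54 ∷ - + 14 ∷ - + 4 ∷ + 1 ∷ []

-- Applying Qᴿ to the initial state gives a combination with value 0 on two or more columns
-- which is not itself 0, because the counts of different states are linearly dependent.
-- The minimal polynomial of the initial state under column is Qᴿ · x (D⁻ + x⁹).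
D⁻ : List ℤ
D⁻ = + 0 ∷ - + 12 ∷ + 12 ∷ + 43 ∷ - + 55 ∷ - + 10 ∷ + 29 ∷ - + 4 ∷ - + 4 ∷ []

_≟ᶻ_ : DecidableEquality (List ℤ)
_≟ᶻ_ = List.≡-dec ℤ._≟_

-- Ten values are compared: the one at 0, which the factor x of the annihilator leaves free, and
-- nine zeros to start the recurrence of order nine. The value `- + 3` is the coefficient of x¹⁴ in
-- `P`, whose degree exceeds that of `Q` by one.
certificate : Tree → Bool
certificate t = isZero (apply (0ℤ ∷ D⁻ ∷ʳ 1ℤ) t) ∧ does (values 10 t ≟ᶻ (- + 3 ∷ replicate 9 0ℤ))

does-true : ∀ {P : Set} (P? : Dec P) → does P? ≡ true → P
does-true (yes p) _ = p

∧-true : ∀ {x y} → x ∧ y ≡ true → x ≡ true × y ≡ true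
∧-true {true} {true} _ = refl , refl

-- With `t` kept abstract, the concrete combination is evaluated only in `residue-certificate`.
certified : ∀ t → certificate t ≡ true → value 0 t ≡ - + 3 × (∀ m → value (suc m) t ≡ 0ℤ)
certified t certificate-eq = initial-value 0 (s≤s z≤n) , λ m → trans
  (cong (λ k → value (suc k) t) (sym (ℕ.+-identityʳ m)))
  (recurrence-zero D⁻ rec (λ k k< → trans (initial-value (suc k) (s≤s k<)) (poly-zeros 9 k)) m 0 z≤n)
  where
  zero-eq : isZero (apply (0ℤ ∷ D⁻ ∷ʳ 1ℤ) t) ≡ true
  zero-eq = proj₁ (∧-true certificate-eq)
  values-eq : does (values 10 t ≟ᶻ (- + 3 ∷ replicate 9 0ℤ)) ≡ true
  values-eq = proj₂ (∧-true {isZero (apply (0ℤ ∷ D⁻ ∷ʳ 1ℤ) t)} certificate-eq)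
  initial-value : ∀ k → k < 10 → value k t ≡ poly (- + 3 ∷ replicate 9 0ℤ) k
  initial-value k k< = trans (sym (poly-applyUpTo (λ m → value m t) k k<))
    (cong (λ l → poly l k) (trans (sym (values-correct 10 t (λ _ → refl)))
      (does-true (values 10 t ≟ᶻ (- + 3 ∷ replicate 9 0ℤ)) values-eq)))
  rec : ∀ m → combination (D⁻ ∷ʳ 1ℤ) (λ k → value (suc k) t) m ≡ 0ℤ
  rec m = begin
    combination (D⁻ ∷ʳ 1ℤ) (λ k → value (suc k) t) m       ≡⟨ combination-suc (D⁻ ∷ʳ 1ℤ) (λ k → value k t) m ⟨
    combination (D⁻ ∷ʳ 1ℤ) (λ k → value k t) (suc m)       ≡⟨ ℤ.+-identityˡ _ ⟨
    combination (0ℤ ∷ D⁻ ∷ʳ 1ℤ) (λ k → value k t) m        ≡⟨ value-apply (0ℤ ∷ D⁻ ∷ʳ 1ℤ) t m ⟨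
    value m (apply (0ℤ ∷ D⁻ ∷ʳ 1ℤ) t)                      ≡⟨ eval-isZero (count (m * 5)) (apply (0ℤ ∷ D⁻ ∷ʳ 1ℤ) t) zero-eq ⟩
    0ℤ                                                     ∎
    where open ≡-Reasoning

-- The numbers for 1 to 13 columns. Together with the conventional 1 for no columns they determine
-- the product with `Q` in all degrees below 14.
tours : List ℤ
tours = + 1 ∷ + 5 ∷ + 38 ∷ + 160 ∷ + 824 ∷ + 3501 ∷ + 16262 ∷ + 68591
  ∷ + 304177 ∷ + 1276805 ∷ + 5522791 ∷ + 23117164 ∷ + 98562435 ∷ []

initial-certificate : does (values 13 initial ≟ᶻ tours) ≡ true
initial-certificate = refl

residue-certificate : certificate (apply Qᴿ initial) ≡ true
residue-certificate = refl

Q-degree : DegreeBelow 14 Q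
Q-degree = ⊛-degree 7 6
  (⊛-degree 1 6 (poly-degree (+ 1 ∷ + 1 ∷ [])) (poly-degree (+ 1 ∷ + 0 ∷ - + 11 ∷ + 0 ∷ + 0 ∷ + 0 ∷ - + 2 ∷ [])))
  (poly-degree (+ 1 ∷ - + 5 ∷ + 2 ∷ + 8 ∷ - + 8 ∷ + 1 ∷ - + 1 ∷ []))

Q-reversed : applyUpTo (λ i → Q (13 ∸ i)) 14 ≡ Qᴿ
Q-reversed = refl

P-head : applyUpTo (poly (+ 1 ∷ tours) ⊛ Q) 14 ≡ applyUpTo P 14
P-head = refl

P-degree : DegreeBelow 15 P
P-degree = poly-degree _

module _ {a : Series} {t : Tree} (a⁺ : ∀ m → value m t ≡ a (suc m)) where

  ⊛Q-head : a 0 ≡ + 1 → does (values 13 t ≟ᶻ tours) ≡ true → ∀ n → n < 14 → (a ⊛ Q) n ≡ P n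
  ⊛Q-head a₀ eq n n< = begin
    (a ⊛ Q) n                                       ≡⟨ ⊛-prefix Q n (λ i i≤n → prefix i (ℕ.≤-<-trans i≤n n<)) ⟩
    (poly (+ 1 ∷ tours) ⊛ Q) n                      ≡⟨ poly-applyUpTo (poly (+ 1 ∷ tours) ⊛ Q) n n< ⟨
    poly (applyUpTo (poly (+ 1 ∷ tours) ⊛ Q) 14) n  ≡⟨ cong (λ cs → poly cs n) P-head ⟩
    poly (applyUpTo P 14) n                         ≡⟨ poly-applyUpTo P n n< ⟩
    P n                                             ∎
    where
    open ≡-Reasoning
    prefix : ∀ i → i < 14 → a i ≡ poly (+ 1 ∷ tours) i
    prefix zero    _        = a₀
    prefix (suc i) (s≤s i<) = trans (sym (poly-applyUpTo (a ∘ suc) i i<))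
      (cong (λ cs → poly cs i) (trans (sym (values-correct 13 t a⁺)) (does-true (values 13 t ≟ᶻ tours) eq)))

  ⊛Q-tail : ∀ {u} → (∀ m → value m u ≡ combination Qᴿ (λ k → value k t) m) → certificate u ≡ true →
            ∀ m → (a ⊛ Q) (m + 14) ≡ P (m + 14)
  ⊛Q-tail {u} u-value eq m = begin
    -- As `Q` has degree 13, the product in degree `m + 14` involves `a` from index `suc m` on. The
    -- conventional `a 0` does not enter, and the coefficients used are all values of `t`.
    (a ⊛ Q) (m + 14)                                        ≡⟨ cong (a ⊛ Q) (ℕ.+-suc m 13) ⟩
    (a ⊛ Q) (suc m + 13)                                    ≡⟨ ⊛-tail a 13 Q-degree (suc m) ⟩
    combination (applyUpTo (λ i → Q (13 ∸ i)) 14) a (suc m) ≡⟨ cong (λ cs → combination cs a (suc m)) Q-reversed ⟩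
    combination Qᴿ a (suc m)                                ≡⟨ combination-suc Qᴿ a m ⟩
    combination Qᴿ (λ k → a (suc k)) m                      ≡⟨ combination-cong Qᴿ a⁺ m ⟨
    combination Qᴿ (λ k → value k t) m                      ≡⟨ u-value m ⟨
    value m u                                               ≡⟨ u≡P m ⟩
    P (m + 14)                                              ∎
    where
    open ≡-Reasoning
    u≡P : ∀ m → value m u ≡ P (m + 14)
    u≡P zero    = proj₁ (certified u eq)
    u≡P (suc m) = trans (proj₂ (certified u eq) m) (sym (P-degree (suc m + 14) (s≤s (ℕ.m≤n+m 14 m))))

value-initial : ∀ m → value m initial ≡ G 5 (suc m)
value-initial m = trans (ℤ.+-identityˡ _) (trans (ℤ.+-identityʳ _) (trans (ℤ.*-identityˡ _) (cong +_ (sym (g≡count m)))))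

mainTheorem10 : G 5 ≈ P ÷ Q
mainTheorem10 = refl , coefficient
  where
  coefficient : G 5 ⊛ Q ≈ P
  coefficient n with n ℕ.<? 14
  ... | yes n<14 = ⊛Q-head {G 5} {initial} value-initial refl initial-certificate n n<14
  ... | no  n≮14 = subst (λ n → (G 5 ⊛ Q) n ≡ P n) (ℕ.m∸n+n≡m (ℕ.≮⇒≥ n≮14))
    (⊛Q-tail {G 5} {initial} value-initial {apply Qᴿ initial} (value-apply Qᴿ initial) residue-certificate (n ∸ 14))
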